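{- Let $T$ be a tree of order $n\ge 9$. If $T\not\cong F_n$, then $d(T)\le h(n)$, and equality holds if and only if $T\cong T_n$, where \[ h(n)=\begin{cases}2^{n-1}+(n+9)\cdot 2^{\frac{n-7}{2}} & n \text{ odd},\\ 2^{n-1}+(n+12)\cdot 2^{\frac{n-8}{2}} & n\text{ even},\end{cases}\qquad F_n=\begin{cases}K_1*\tfrac{n-1}{2}K_2 & n\text{ odd},\\ K_2*\tfrac{n-2}{2}K_2 & n\text{ even},\end{cases}\] \[ T_n=\begin{cases}K_1*\big(2K_1\cup \tfrac{n-3}{2}K_2\big) & n\text{ odd},\\ K_1*\big(3K_1\cup\tfrac{n-4}{2}K_2\big) & n\text{ even}.\end{cases}\]
   Context: All graphs are finite, simple and undirected. A subset $S$ of vertices of a graph $G$ is a dissociation set if the subgraph induced by $S$ has maximum degree at most one (the empty set is a dissociation set). $d(G)$ denotes the total number of dissociation sets of $G$ (including the empty set). $sK_1\cup tK_2$ denotes the disjoint union of $s$ isolated vertices and $t$ disjoint edges; $tK_2$ is the disjoint union of $t$ edges. The operation $*$: if $H=K_{s_1}\cup\cdots\cup K_{s_t}$ is a disjoint union of complete graphs and $K_r$ is a complete graph disjoint from $H$, then $K_r*H$ is the graph obtained from $K_r\cup H$ by choosing one vertex $u$ of $K_r$ and joining $u$ to exactly one vertex of each component of $H$ (the result is independent of choices up to isomorphism). -}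

module Defs where

open import Data.Nat using (ℕ; zero; suc; _+_; _*_; _∸_; _^_; _≤_; _≡ᵇ_; _<ᵇ_; _%_; ⌊_/2⌋)
open import Data.Bool using (Bool; true; false; _∧_; _∨_; not; if_then_else_)
open import Data.Bool.Properties using (∨-comm)
open import Data.Fin using (Fin; toℕ)
open import Data.Fin.Properties using (all?)
open import Data.Fin.Subset using (Subset; _∈_)
open import Data.Fin.Subset.Properties using (_∈?_)
open import Data.Vec using (Vec; []; _∷_; lookup)
open import Data.List using (List; []; _∷_; _++_; length; map; filter; allFin; concatMap)
open import Data.Nat.ListAction using (sum)
open import Data.List.Relation.Unary.Unique.Propositional using (Unique)
open import Data.List.Relation.Unary.Linked using (Linked)
open import Data.Product using (Σ; _×_; ∃)
open import Data.Nat.Properties using (_≤?_)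
open import Relation.Nullary using (Dec; ¬_)
open import Relation.Binary.PropositionalEquality using (_≡_; refl; cong₂)

record Graph (n : ℕ) : Set where
  field
    adj    : Fin n → Fin n → Bool
    sym    : ∀ i j → adj i j ≡ adj j i
    irrefl : ∀ i → adj i i ≡ false
open Graph public

Adj : ∀ {n} → Graph n → Fin n → Fin n → Set
Adj G i j = adj G i j ≡ true

private
  ≡ᵇ-sym : ∀ a b → (a ≡ᵇ b) ≡ (b ≡ᵇ a)
  ≡ᵇ-sym zero zero = refl
  ≡ᵇ-sym zero (suc b) = refl
  ≡ᵇ-sym (suc a) zero = refl
  ≡ᵇ-sym (suc a) (suc b) = ≡ᵇ-sym a b

  ≡ᵇ-refl : ∀ a → (a ≡ᵇ a) ≡ true
  ≡ᵇ-refl zero = refl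
  ≡ᵇ-refl (suc a) = ≡ᵇ-refl a

fromRel : ∀ {n} → (Fin n → Fin n → Bool) → Graph n
fromRel R = record
  { adj    = λ i j → not (toℕ i ≡ᵇ toℕ j) ∧ (R i j ∨ R j i)
  ; sym    = λ i j → cong₂ (λ x y → not x ∧ y) (≡ᵇ-sym (toℕ i) (toℕ j)) (∨-comm (R i j) (R j i))
  ; irrefl = λ i → irr i
  }
  where
  irr : ∀ i → not (toℕ i ≡ᵇ toℕ i) ∧ (R i i ∨ R i i) ≡ false
  irr i with toℕ i ≡ᵇ toℕ i | ≡ᵇ-refl (toℕ i)
  ... | true | _ = refl

data Walk {n} (G : Graph n) : Fin n → Fin n → Set where
  here  : ∀ {u} → Walk G u u
  there : ∀ {u v w} → Adj G u v → Walk G v w → Walk G u w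

Connected : ∀ {n} → Graph n → Set
Connected G = ∀ u v → Walk G u v

IsCycle : ∀ {n} → Graph n → Fin n → List (Fin n) → Set
IsCycle G u ys = (2 ≤ length ys) × Unique (u ∷ ys) × Linked (Adj G) (u ∷ ys ++ u ∷ [])

Acyclic : ∀ {n} → Graph n → Set
Acyclic {n} G = ¬ (Σ (Fin n) λ u → Σ (List (Fin n)) λ ys → IsCycle G u ys)

IsTree : ∀ {n} → Graph n → Set
IsTree G = Connected G × Acyclic G

record _≅_ {n m} (G : Graph n) (H : Graph m) : Set where
  field
    to       : Fin n → Fin m
    from     : Fin m → Fin n
    from∘to  : ∀ i → from (to i) ≡ i
    to∘from  : ∀ j → to (from j) ≡ j
    preserve : ∀ i j → adj H (to i) (to j) ≡ adj G i j

degIn : ∀ {n} → Graph n → Subset n → Fin n → ℕ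
degIn {n} G S v = sum (map (λ u → if lookup S u ∧ adj G v u then 1 else 0) (allFin n))

IsDissociation : ∀ {n} → Graph n → Subset n → Set
IsDissociation G S = ∀ v → v ∈ S → degIn G S v ≤ 1

isDissociation? : ∀ {n} (G : Graph n) (S : Subset n) → Dec (IsDissociation G S)
isDissociation? G S = all? (λ v → imp (v ∈? S) (degIn G S v ≤? 1))
  where
  open import Relation.Nullary.Decidable using (_→-dec_)
  imp = _→-dec_

allSubsets : ∀ n → List (Subset n)
allSubsets zero = [] ∷ []
allSubsets (suc n) = concatMap (λ S → (true ∷ S) ∷ (false ∷ S) ∷ []) (allSubsets n)

d : ∀ {n} → Graph n → ℕ
d {n} G = length (filter (isDissociation? G) (allSubsets n))

-- The graphs F_n, T_n (vertex 0 is the vertex u of the * operation)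

isEven : ℕ → Bool
isEven n = n % 2 ≡ᵇ 0

-- n odd: K₁ * ((n-1)/2)K₂ : 0 ~ b for odd b ≥ 1 ; b ~ b-1 for even b ≥ 2
F-odd : ℕ → ℕ → Bool
F-odd a b = ((a ≡ᵇ 0) ∧ not (isEven b)) ∨ (isEven b ∧ (1 <ᵇ b) ∧ (a ≡ᵇ b ∸ 1))

-- n even: K₂ * ((n-2)/2)K₂ : K₂ = {0,1}; 0 ~ b for even b ≥ 2 ; b ~ b-1 for odd b ≥ 3
F-even : ℕ → ℕ → Bool
F-even a b = ((a ≡ᵇ 0) ∧ (b ≡ᵇ 1))
           ∨ ((a ≡ᵇ 0) ∧ isEven b ∧ (1 <ᵇ b))
           ∨ (not (isEven b) ∧ (2 <ᵇ b) ∧ (a ≡ᵇ b ∸ 1))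

-- n odd: K₁ * (2K₁ ∪ ((n-3)/2)K₂) : 0 ~ 1, 2 ; 0 ~ odd b ≥ 3 ; b ~ b-1 for even b ≥ 4
T-odd : ℕ → ℕ → Bool
T-odd a b = ((a ≡ᵇ 0) ∧ ((b ≡ᵇ 1) ∨ (b ≡ᵇ 2)))
          ∨ ((a ≡ᵇ 0) ∧ not (isEven b) ∧ (2 <ᵇ b))
          ∨ (isEven b ∧ (3 <ᵇ b) ∧ (a ≡ᵇ b ∸ 1))

-- n even: K₁ * (3K₁ ∪ ((n-4)/2)K₂) : 0 ~ 1, 2, 3 ; 0 ~ even b ≥ 4 ; b ~ b-1 for odd b ≥ 5
T-even : ℕ → ℕ → Bool
T-even a b = ((a ≡ᵇ 0) ∧ ((b ≡ᵇ 1) ∨ (b ≡ᵇ 2) ∨ (b ≡ᵇ 3)))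
           ∨ ((a ≡ᵇ 0) ∧ isEven b ∧ (3 <ᵇ b))
           ∨ (not (isEven b) ∧ (4 <ᵇ b) ∧ (a ≡ᵇ b ∸ 1))

F : ∀ n → Graph n
F n = fromRel (λ i j → (if isEven n then F-even else F-odd) (toℕ i) (toℕ j))

Tn : ∀ n → Graph n
Tn n = fromRel (λ i j → (if isEven n then T-even else T-odd) (toℕ i) (toℕ j))

h : ℕ → ℕ
h n = if isEven n
      then 2 ^ (n ∸ 1) + (n + 12) * 2 ^ ⌊ n ∸ 8 /2⌋
      else 2 ^ (n ∸ 1) + (n + 9) * 2 ^ ⌊ n ∸ 7 /2⌋

{-# OPTIONS --safe #-}
-- Deleting vertices or edges never decreases d(G) / 2^|G|. For a centre u whose deletion leaves only
-- components of order at most 2 the tree is a "spider" with a legs of length 1 and b legs of length 2, for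
-- which 2 d = 2^n + (2a + b + 2) 2^b; trading two short legs for a long one increases this, so past F_n (a
-- ≤ 1) the maximum is T_n (a = 2, 3).
-- If there is no such centre, then following at every vertex an edge into a component of order at least 3
-- must turn back, which yields an edge with at least 3 vertices on both sides, hence one of three subtrees
-- of order 6. A finite search over all ways to grow these inside T shows that d < h(n) once T is exhausted
-- at order 9 or 10, and that otherwise a subtree of order at most 11 has d ≤ 2^(k-1), whence d(T) ≤ 2^(n-1)
-- < h(n).
module Submission where

open import Defs
open import Algebra.Properties.CommutativeSemigroup using (interchange)
open import Data.Bool as Bool using (Bool; true; false; _∧_; _∨_; not; if_then_else_; T)
open import Data.Bool.ListAction using (any)
open import Data.Bool.Properties using (¬-not; ∧-zeroʳ; ∨-comm; ∨-zeroʳ)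
open import Data.Empty using (⊥)
open import Data.Fin as Fin using (Fin; zero; suc; punchIn; punchOut; toℕ)
open import Data.Fin.Properties using (any?; injective⇒≤; punchIn-injective; punchIn-punchOut; punchInᵢ≢i; suc-injective)
open import Data.List as List using (List; []; _∷_; _++_; concatMap; filter; length; replicate)
open import Data.List.Membership.DecPropositional using () renaming (_∈?_ to member?)
open import Data.List.Membership.Propositional using (_∈_)
open import Data.List.Membership.Propositional.Properties using (∈-++⁺ˡ; ∈-++⁺ʳ; ∈-allFin; ∈-filter⁺; ∈-filter⁻; ∈-lookup; ∈-map⁺; ∈-∃++)
open import Data.List.Properties using (length-map)
open import Data.List.Relation.Unary.All as All using (All; []; _∷_)
open import Data.List.Relation.Unary.All.Properties using (++⁻ˡ; ++⁻ʳ; ¬Any⇒All¬)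
open import Data.List.Relation.Unary.AllPairs using ([]; _∷_)
open import Data.List.Relation.Unary.Any using (here; there)
open import Data.List.Relation.Unary.Linked using (Linked; [-]; _∷_)
open import Data.List.Relation.Unary.Unique.Propositional using (Unique)
import Data.List.Relation.Unary.Unique.Propositional.Properties as Unique
open import Data.Nat
open import Data.Nat.ListAction using (sum)
open import Data.Nat.Properties hiding (suc-injective)
open import Data.Nat.Solver using (module +-*-Solver)
open import Data.Product using (_×_; _,_; ∃; proj₁; proj₂)
open import Data.Sum using (_⊎_; inj₁; inj₂; [_,_]′)
open import Data.Unit using (tt)
open import Data.Vec as Vec using (Vec; []; _∷_; insertAt; lookup; tabulate; _[_]≔_)
open import Data.Vec.Properties using (insertAt-lookup; insertAt-punchIn; lookup-map; lookup∘tabulate; lookup∘update; lookup∘update′; lookup⇒[]=; []=⇒lookup; tabulate-cong; tabulate∘lookup; ≡-dec)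
import Data.Vec.Relation.Unary.All as VecAll
open import Data.Vec.Relation.Unary.All using ([]; _∷_)
import Data.Vec.Relation.Unary.All.Properties as VecAll
open import Function using (_∘_; id)
open import Function.Bundles using (_⇔_; mk⇔)
open import Function.Definitions using (Injective)
open import Relation.Binary.PropositionalEquality renaming (sym to ≡-sym)
open import Relation.Nullary using (Dec; yes; no; does; ¬_; contradiction)
open import Relation.Nullary.Decidable using (dec-true; decidable-stable; ¬?; _×-dec_; _⊎-dec_)
open import Relation.Unary using (Pred; Decidable)

-- The ratio d/2^n loses the lower-order term of `h`, so it settles a tree only once it has dropped
-- to 1/2. This does not yet happen at order 6: the three starting trees have 41, 42 and 44
-- dissociation sets among 64 subsets. Nor does it always happen at order 9: the path has 274 > 256,
-- still below h(9) = 292. Hence the starting trees must be grown, and growth that ends at order 9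
-- or 10 is compared with `h` itself. No spider can be treated by the ratio: every set avoiding the
-- centre is a dissociation set, which alone gives 2^(n-1), so there the excess has to be computed
-- exactly. A new leaf interacts with a dissociation set only through the state of the vertex it is
-- attached to; this is why three labels per vertex suffice to update the list of sets. Ratios are
-- cross-multiplied throughout to stay in the natural numbers.

indicator : Bool → ℕ
indicator b = if b then 1 else 0

-- Counting Boolean vectors

count : ∀ n → (Vec Bool n → Bool) → ℕ
count zero    P = indicator (P [])
count (suc n) P = count n (P ∘ (true ∷_)) + count n (P ∘ (false ∷_))

indicator-mono : ∀ {a b} → (a ≡ true → b ≡ true) → indicator a ≤ indicator b
indicator-mono {false}        _ = z≤n
indicator-mono {true} {true}  _ = ≤-refl
indicator-mono {true} {false} f with () ← f refl

count-mono : ∀ n {P Q} → (∀ S → P S ≡ true → Q S ≡ true) → count n P ≤ count n Q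
count-mono zero    imp = indicator-mono (imp [])
count-mono (suc n) imp = +-mono-≤ (count-mono n (imp ∘ (true ∷_))) (count-mono n (imp ∘ (false ∷_)))

count-cong : ∀ n {P Q} → (∀ S → P S ≡ Q S) → count n P ≡ count n Q
count-cong zero    eq = cong indicator (eq [])
count-cong (suc n) eq = cong₂ _+_ (count-cong n (eq ∘ (true ∷_))) (count-cong n (eq ∘ (false ∷_)))

count-false : ∀ n → count n (λ _ → false) ≡ 0
count-false zero    = refl
count-false (suc n) = cong₂ _+_ (count-false n) (count-false n)

count-true : ∀ n → count n (λ _ → true) ≡ 2 ^ n
count-true zero    = refl
count-true (suc n) = cong₂ _+_ (count-true n) (trans (count-true n) (≡-sym (+-identityʳ _)))

count-∨ : ∀ n {P Q} → count n (λ S → P S ∨ Q S) ≤ count n P + count n Q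
count-∨ zero {P} {Q} with P [] | Q []
... | true  | _     = s≤s z≤n
... | false | true  = ≤-refl
... | false | false = z≤n
count-∨ (suc n) {P} {Q} = ≤-trans
  (+-mono-≤ (count-∨ n) (count-∨ n))
  (≤-reflexive (interchange +-commutativeSemigroup (count n (P ∘ (true ∷_))) _ _ _))

count-point : ∀ n b → count n (λ S → does (≡-dec Bool._≟_ S b)) ≤ 1
count-point zero    []      = ≤-refl
count-point (suc n) (true ∷ b) = subst (_≤ 1)
  (≡-sym (trans (cong₂ _+_ (count-cong n (λ S → refl)) (count-false n)) (+-identityʳ _))) (count-point n b)
count-point (suc n) (false ∷ b) = subst (_≤ 1)
  (≡-sym (cong₂ _+_ (count-false n) (count-cong n (λ S → refl)))) (count-point n b)

-- A union bound. Only upper bounds on `d` are wanted from lists, so repetitions in `bs` do no harm.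
count-list : ∀ n (bs : List (Vec Bool n)) → count n (λ S → any (λ b → does (≡-dec Bool._≟_ S b)) bs) ≤ length bs
count-list n []       = ≤-reflexive (count-false n)
count-list n (b ∷ bs) = ≤-trans (count-∨ n) (+-mono-≤ (count-point n b) (count-list n bs))

count-insertAt : ∀ k (i : Fin (suc k)) P →
  count (suc k) P ≡ count k (λ S → P (insertAt S i true)) + count k (λ S → P (insertAt S i false))
count-insertAt k       zero    P = refl
count-insertAt (suc k) (suc i) P = trans
  (cong₂ _+_ (count-insertAt k i (P ∘ (true ∷_))) (count-insertAt k i (P ∘ (false ∷_))))
  (interchange +-commutativeSemigroup (count k (λ S → P (true ∷ insertAt S i true))) _ _ _)

restrict : ∀ {n k} → (Fin k → Fin n) → Vec Bool n → Vec Bool k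
restrict φ S = tabulate (lookup S ∘ φ)

restrict-lookup : ∀ {n k} (φ : Fin k → Fin n) S i → lookup (restrict φ S) i ≡ lookup S (φ i)
restrict-lookup φ S i = lookup∘tabulate _ i

restrict-suc : ∀ {n k} (φ : Fin k → Fin (suc n)) (φ′ : Fin k → Fin n) → (∀ i → φ i ≡ suc (φ′ i)) →
  ∀ b S → restrict φ (b ∷ S) ≡ restrict φ′ S
restrict-suc φ φ′ eq b S = tabulate-cong λ i → cong (lookup (b ∷ S)) (eq i)

punchIn-cover : ∀ {n} (i j : Fin (suc n)) → ¬ i ≡ j → ∃ λ j′ → punchIn i j′ ≡ j
punchIn-cover i j i≢j = punchOut i≢j , punchIn-punchOut i≢j

lookup-ext : ∀ {a} {A : Set a} {k} (xs ys : Vec A k) → (∀ i → lookup xs i ≡ lookup ys i) → xs ≡ ys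
lookup-ext xs ys eq = trans (≡-sym (tabulate∘lookup xs)) (trans (tabulate-cong eq) (tabulate∘lookup ys))

-- Every vector of length k has 2^(n-k) extensions along `φ`. Induction on n: if `φ` misses
-- coordinate 0, the two halves agree and `φ` is lowered; if `φ` sends `i₀` there, the bit at `i₀`
-- is fixed and `i₀` is removed from the domain.
count-restrict : ∀ n k (φ : Fin k → Fin n) → Injective _≡_ _≡_ φ → ∀ P →
  count n (P ∘ restrict φ) * 2 ^ k ≡ count k P * 2 ^ n
count-restrict zero zero φ inj P = refl
count-restrict zero (suc k) φ inj P with () ← φ zero
count-restrict (suc n) k φ inj P with any? (λ i → φ i Fin.≟ zero)
... | no avoid = begin
  (count n (P ∘ restrict φ ∘ (true ∷_)) + count n (P ∘ restrict φ ∘ (false ∷_))) * 2 ^ k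
    ≡⟨ cong (_* 2 ^ k) (cong₂ _+_ (half true) (half false)) ⟩
  (count n (P ∘ restrict φ′) + count n (P ∘ restrict φ′)) * 2 ^ k
    ≡⟨ *-distribʳ-+ (2 ^ k) (count n (P ∘ restrict φ′)) _ ⟩
  count n (P ∘ restrict φ′) * 2 ^ k + count n (P ∘ restrict φ′) * 2 ^ k
    ≡⟨ cong₂ _+_ IH IH ⟩
  count k P * 2 ^ n + count k P * 2 ^ n
    ≡⟨ *-distribˡ-+ (count k P) (2 ^ n) (2 ^ n) ⟨
  count k P * (2 ^ n + 2 ^ n)
    ≡⟨ cong (λ x → count k P * (2 ^ n + x)) (+-identityʳ (2 ^ n)) ⟨
  count k P * 2 ^ suc n ∎
  where
  open ≡-Reasoning
  0≢ : ∀ i → ¬ zero ≡ φ i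
  0≢ i eq = avoid (i , ≡-sym eq)
  φ′ : Fin k → Fin n
  φ′ i = punchOut (0≢ i)
  φ-suc : ∀ i → φ i ≡ suc (φ′ i)
  φ-suc i = ≡-sym (punchIn-punchOut (0≢ i))
  half : ∀ b → count n (P ∘ restrict φ ∘ (b ∷_)) ≡ count n (P ∘ restrict φ′)
  half b = count-cong n λ S → cong P (restrict-suc φ φ′ φ-suc b S)
  IH = count-restrict n k φ′ (λ {i} {j} eq → inj (trans (φ-suc i) (trans (cong suc eq) (≡-sym (φ-suc j))))) P
count-restrict (suc n) (suc k) φ inj P | yes (i₀ , φi₀≡0) = begin
  (count n (P ∘ restrict φ ∘ (true ∷_)) + count n (P ∘ restrict φ ∘ (false ∷_))) * 2 ^ suc k
    ≡⟨ cong (_* 2 ^ suc k) (cong₂ _+_ (half true) (half false)) ⟩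
  (X + Y) * (2 * 2 ^ k)
    ≡⟨ *-comm-assoc (X + Y) 2 (2 ^ k) ⟩
  2 * ((X + Y) * 2 ^ k)
    ≡⟨ cong (2 *_) (*-distribʳ-+ (2 ^ k) X Y) ⟩
  2 * (X * 2 ^ k + Y * 2 ^ k)
    ≡⟨ cong (2 *_) (cong₂ _+_ (IH true) (IH false)) ⟩
  2 * (count k (ins true) * 2 ^ n + count k (ins false) * 2 ^ n)
    ≡⟨ cong (2 *_) (*-distribʳ-+ (2 ^ n) (count k (ins true)) _) ⟨
  2 * ((count k (ins true) + count k (ins false)) * 2 ^ n)
    ≡⟨ *-comm-assoc (count k (ins true) + count k (ins false)) 2 (2 ^ n) ⟨
  (count k (ins true) + count k (ins false)) * 2 ^ suc n
    ≡⟨ cong (_* 2 ^ suc n) (count-insertAt k i₀ P) ⟨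
  count (suc k) P * 2 ^ suc n ∎
  where
  open ≡-Reasoning
  *-comm-assoc : ∀ a b c → a * (b * c) ≡ b * (a * c)
  *-comm-assoc a b c = trans (≡-sym (*-assoc a b c)) (trans (cong (_* c) (*-comm a b)) (*-assoc b a c))
  0≢ : ∀ j → ¬ zero ≡ φ (punchIn i₀ j)
  0≢ j eq = punchInᵢ≢i i₀ j (inj (≡-sym (trans φi₀≡0 eq)))
  φ′ : Fin k → Fin n
  φ′ j = punchOut (0≢ j)
  φ-suc : ∀ j → φ (punchIn i₀ j) ≡ suc (φ′ j)
  φ-suc j = ≡-sym (punchIn-punchOut (0≢ j))
  φ′-inj : Injective _≡_ _≡_ φ′
  φ′-inj {i} {j} eq = punchIn-injective i₀ i j (inj (trans (φ-suc i) (trans (cong suc eq) (≡-sym (φ-suc j)))))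
  ins : Bool → Vec Bool k → Bool
  ins b S = P (insertAt S i₀ b)
  split : ∀ b S → restrict φ (b ∷ S) ≡ insertAt (restrict φ′ S) i₀ b
  split b S = lookup-ext _ _ pointwise
    where
    pointwise : ∀ j → lookup (restrict φ (b ∷ S)) j ≡ lookup (insertAt (restrict φ′ S) i₀ b) j
    pointwise j with i₀ Fin.≟ j
    ... | yes refl = trans (restrict-lookup φ (b ∷ S) i₀) (trans (cong (lookup (b ∷ S)) φi₀≡0) (≡-sym (insertAt-lookup (restrict φ′ S) i₀ b)))
    ... | no i₀≢j with punchIn-cover i₀ j i₀≢j
    ... | j′ , refl = trans (restrict-lookup φ (b ∷ S) (punchIn i₀ j′)) (trans (cong (lookup (b ∷ S)) (φ-suc j′))
            (≡-sym (trans (insertAt-punchIn (restrict φ′ S) i₀ b j′) (restrict-lookup φ′ S j′))))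
  half : ∀ b → count n (P ∘ restrict φ ∘ (b ∷_)) ≡ count n (ins b ∘ restrict φ′)
  half b = count-cong n λ S → cong P (split b S)
  IH : ∀ b → count n (ins b ∘ restrict φ′) * 2 ^ k ≡ count k (ins b) * 2 ^ n
  IH b = count-restrict n k φ′ φ′-inj (ins b)
  X = count n (ins true ∘ restrict φ′)
  Y = count n (ins false ∘ restrict φ′)

-- Dissociation sets

length-filter-∷ : ∀ {A : Set} {p} {P : Pred A p} (P? : Decidable P) x xs →
  length (filter P? (x ∷ xs)) ≡ indicator (does (P? x)) + length (filter P? xs)
length-filter-∷ P? x xs with does (P? x)
... | true  = refl
... | false = refl

filter-branch : ∀ {n p} {P : Pred (Vec Bool (suc n)) p} (P? : Decidable P) xs →
  length (filter P? (concatMap (λ S → (true ∷ S) ∷ (false ∷ S) ∷ []) xs)) ≡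
  length (filter (P? ∘ (true ∷_)) xs) + length (filter (P? ∘ (false ∷_)) xs)
filter-branch P? []       = refl
filter-branch P? (S ∷ xs) = begin
  length (filter P? ((true ∷ S) ∷ (false ∷ S) ∷ rest))
    ≡⟨ length-filter-∷ P? _ _ ⟩
  a + length (filter P? ((false ∷ S) ∷ rest))
    ≡⟨ cong (a +_) (length-filter-∷ P? _ _) ⟩
  a + (b + length (filter P? rest))
    ≡⟨ cong (λ x → a + (b + x)) (filter-branch P? xs) ⟩
  a + (b + (length (filter (P? ∘ (true ∷_)) xs) + length (filter (P? ∘ (false ∷_)) xs)))
    ≡⟨ +-assoc a b _ ⟨
  a + b + (length (filter (P? ∘ (true ∷_)) xs) + length (filter (P? ∘ (false ∷_)) xs))
    ≡⟨ interchange +-commutativeSemigroup a b _ _ ⟩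
  a + length (filter (P? ∘ (true ∷_)) xs) + (b + length (filter (P? ∘ (false ∷_)) xs))
    ≡⟨ cong₂ _+_ (length-filter-∷ (P? ∘ (true ∷_)) S xs) (length-filter-∷ (P? ∘ (false ∷_)) S xs) ⟨
  length (filter (P? ∘ (true ∷_)) (S ∷ xs)) + length (filter (P? ∘ (false ∷_)) (S ∷ xs)) ∎
  where
  open ≡-Reasoning
  a = indicator (does (P? (true ∷ S)))
  b = indicator (does (P? (false ∷ S)))
  rest = concatMap (λ S → (true ∷ S) ∷ (false ∷ S) ∷ []) xs

length-filter-allSubsets : ∀ n {p} {P : Pred (Vec Bool n) p} (P? : Decidable P) →
  length (filter P? (allSubsets n)) ≡ count n (does ∘ P?)
length-filter-allSubsets zero P? with does (P? [])
... | true  = refl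
... | false = refl
length-filter-allSubsets (suc n) P? = trans (filter-branch P? (allSubsets n))
  (cong₂ _+_ (length-filter-allSubsets n (P? ∘ (true ∷_))) (length-filter-allSubsets n (P? ∘ (false ∷_))))

d≡count : ∀ {n} (G : Graph n) → d G ≡ count n (does ∘ isDissociation? G)
d≡count {n} G = length-filter-allSubsets n (isDissociation? G)

-- Degree at most one, phrased as coincidence of chosen neighbours. Unlike a bound on a sum, this
-- form passes directly through injective maps of vertices.
Dissociated : ∀ {n} → Graph n → Vec Bool n → Set
Dissociated G S = ∀ v x y → lookup S v ≡ true → lookup S x ≡ true → lookup S y ≡ true →
  Adj G v x → Adj G v y → x ≡ y

module _ {A : Set} (p : A → Bool) where

  tally : List A → ℕ
  tally xs = sum (List.map (indicator ∘ p) xs)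

  tally-∈ : ∀ {x xs} → x ∈ xs → p x ≡ true → 1 ≤ tally xs
  tally-∈ {xs = y ∷ xs} (here refl) px rewrite px = s≤s z≤n
  tally-∈ {xs = y ∷ xs} (there x∈) px = ≤-trans (tally-∈ x∈ px) (m≤n+m _ _)

  tally≤1⇒unique : ∀ {xs x y} → tally xs ≤ 1 → x ∈ xs → y ∈ xs → p x ≡ true → p y ≡ true → x ≡ y
  tally≤1⇒unique le (here refl) (here refl) px py = refl
  tally≤1⇒unique le (here refl) (there y∈) px py rewrite px = contradiction (≤-trans (s≤s (tally-∈ y∈ py)) le) λ { (s≤s ()) }
  tally≤1⇒unique le (there x∈) (here refl) px py rewrite py = contradiction (≤-trans (s≤s (tally-∈ x∈ px)) le) λ { (s≤s ()) }
  tally≤1⇒unique {xs = z ∷ xs} le (there x∈) (there y∈) px py = tally≤1⇒unique (≤-trans (m≤n+m _ _) le) x∈ y∈ px py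

  tally≡0 : ∀ {xs} → (∀ {x} → x ∈ xs → ¬ p x ≡ true) → tally xs ≡ 0
  tally≡0 {[]}     none = refl
  tally≡0 {x ∷ xs} none with p x in px
  ... | true  = contradiction px (none (here refl))
  ... | false = tally≡0 (none ∘ there)

  unique⇒tally≤1 : ∀ {xs} → Unique xs → (∀ {x y} → x ∈ xs → y ∈ xs → p x ≡ true → p y ≡ true → x ≡ y) → tally xs ≤ 1
  unique⇒tally≤1 {[]}     _ _ = z≤n
  unique⇒tally≤1 {x ∷ xs} (x∉ ∷ xs!) uniq with p x in px
  ... | true  = s≤s (≤-reflexive (tally≡0 λ y∈ py → All.lookup x∉ y∈ (uniq (here refl) (there y∈) px py)))
  ... | false = unique⇒tally≤1 xs! (λ x∈ y∈ → uniq (there x∈) (there y∈))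

∧-true : ∀ {a b} → a ≡ true → b ≡ true → a ∧ b ≡ true
∧-true refl refl = refl

∧-true⁻ : ∀ {a b} → a ∧ b ≡ true → a ≡ true × b ≡ true
∧-true⁻ {true} {true} _ = refl , refl

isDissociation⇒dissociated : ∀ {n} (G : Graph n) S → IsDissociation G S → Dissociated G S
isDissociation⇒dissociated G S diss v x y Sv Sx Sy vx vy =
  tally≤1⇒unique _ (diss v (lookup⇒[]= v S Sv)) (∈-allFin x) (∈-allFin y) (∧-true Sx vx) (∧-true Sy vy)

dissociated⇒isDissociation : ∀ {n} (G : Graph n) S → Dissociated G S → IsDissociation G S
dissociated⇒isDissociation {n} G S diss v v∈S = unique⇒tally≤1 _ (Unique.allFin⁺ n) λ {x} {y} _ _ px py →
  diss v x y ([]=⇒lookup v∈S) (proj₁ (∧-true⁻ px)) (proj₁ (∧-true⁻ py)) (proj₂ (∧-true⁻ {lookup S x} px)) (proj₂ (∧-true⁻ {lookup S y} py))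

does⇒witness : ∀ {A : Set} (A? : Dec A) → does A? ≡ true → A
does⇒witness (yes a) _ = a
does⇒witness (no _) ()

does⇒dissociated : ∀ {n} (G : Graph n) S → does (isDissociation? G S) ≡ true → Dissociated G S
does⇒dissociated G S eq = isDissociation⇒dissociated G S (does⇒witness (isDissociation? G S) eq)

dissociated⇒does : ∀ {n} (G : Graph n) S → Dissociated G S → does (isDissociation? G S) ≡ true
dissociated⇒does G S diss = dec-true (isDissociation? G S) (dissociated⇒isDissociation G S diss)

-- Both ways of bounding `d` start here: `P` may be membership in the dissociation sets of a
-- subgraph, or in a list of patterns produced by the search.
d-restrict : ∀ {n k} (G : Graph n) (φ : Fin k → Fin n) → Injective _≡_ _≡_ φ → ∀ P →
  (∀ S → Dissociated G S → P (restrict φ S) ≡ true) → d G * 2 ^ k ≤ count k P * 2 ^ n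
d-restrict {n} {k} G φ inj P ok = begin
  d G * 2 ^ k
    ≡⟨ cong (_* 2 ^ k) (d≡count G) ⟩
  count n (does ∘ isDissociation? G) * 2 ^ k
    ≤⟨ *-monoˡ-≤ (2 ^ k) (count-mono n λ S eq → ok S (does⇒dissociated G S eq)) ⟩
  count n (P ∘ restrict φ) * 2 ^ k
    ≡⟨ count-restrict n k φ inj P ⟩
  count k P * 2 ^ n ∎
  where open ≤-Reasoning

-- Edges of `H` go to edges, with no converse, so deleting edges is covered along with deleting
-- vertices.
d-subgraph : ∀ {n k} (G : Graph n) (H : Graph k) (φ : Fin k → Fin n) → Injective _≡_ _≡_ φ →
  (∀ i j → Adj H i j → Adj G (φ i) (φ j)) → d G * 2 ^ k ≤ d H * 2 ^ n
d-subgraph {n} {k} G H φ inj edge = subst (λ x → d G * 2 ^ k ≤ x * 2 ^ n) (≡-sym (d≡count H))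
  (d-restrict G φ inj _ λ S diss → dissociated⇒does H (restrict φ S) λ v x y Sv Sx Sy vx vy →
    inj (diss _ _ _ (at S v Sv) (at S x Sx) (at S y Sy) (edge _ _ vx) (edge _ _ vy)))
  where
  at : ∀ S i → lookup (restrict φ S) i ≡ true → lookup S (φ i) ≡ true
  at S i eq = trans (≡-sym (restrict-lookup φ S i)) eq

-- Invariance of d under isomorphism

module _ {n m} {G : Graph n} {H : Graph m} (iso : G ≅ H) where
  open _≅_ iso

  to-injective : Injective _≡_ _≡_ to
  to-injective eq = trans (≡-sym (from∘to _)) (trans (cong from eq) (from∘to _))

  from-injective : Injective _≡_ _≡_ from
  from-injective eq = trans (≡-sym (to∘from _)) (trans (cong to eq) (to∘from _))

  ≅-order : n ≡ m
  ≅-order = ≤-antisym (injective⇒≤ to-injective) (injective⇒≤ from-injective)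

≅-sym : ∀ {n m} {G : Graph n} {H : Graph m} → G ≅ H → H ≅ G
≅-sym {G = G} {H} iso = record
  { to = from ; from = to ; from∘to = to∘from ; to∘from = from∘to
  ; preserve = λ i j → trans (≡-sym (preserve (from i) (from j))) (cong₂ (adj H) (to∘from i) (to∘from j)) }
  where open _≅_ iso

≅-trans : ∀ {n m l} {G : Graph n} {H : Graph m} {K : Graph l} → G ≅ H → H ≅ K → G ≅ K
≅-trans f g = record
  { to = g.to ∘ f.to ; from = f.from ∘ g.from
  ; from∘to = λ i → trans (cong f.from (g.from∘to _)) (f.from∘to i)
  ; to∘from = λ i → trans (cong g.to (f.to∘from _)) (g.to∘from i)
  ; preserve = λ i j → trans (g.preserve _ _) (f.preserve i j) }
  where
  module f = _≅_ f
  module g = _≅_ g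

≅⇒d≤ : ∀ {n m} {G : Graph n} {H : Graph m} → G ≅ H → d G ≤ d H
≅⇒d≤ {n} {m} {G} {H} iso with ≅-order iso
... | refl = *-cancelʳ-≤ (d G) (d H) (2 ^ n) {{m^n≢0 2 n}}
  (d-subgraph G H from (from-injective iso) λ i j e →
     trans (≡-sym (preserve _ _)) (trans (cong₂ (adj H) (to∘from i) (to∘from j)) e))
  where open _≅_ iso

≅⇒d≡ : ∀ {n m} {G : Graph n} {H : Graph m} → G ≅ H → d G ≡ d H
≅⇒d≡ iso = ≤-antisym (≅⇒d≤ iso) (≅⇒d≤ (≅-sym iso))

-- Growing subtrees

-- A chosen vertex is matched once its unique chosen neighbour has been found.
data Label : Set where
  out free matched : Label

branch : ∀ {k} → Vec Label k → Fin k → Label → List (Vec Label (suc k)) → List (Vec Label (suc k))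
branch ℓ p out     rest = (free ∷ ℓ) ∷ rest
branch ℓ p free    rest = (matched ∷ ℓ [ p ]≔ matched) ∷ rest
branch ℓ p matched rest = rest

extend : ∀ {k} → Fin k → List (Vec Label k) → List (Vec Label (suc k))
extend p []       = []
extend p (ℓ ∷ ls) = (out ∷ ℓ) ∷ branch ℓ p (lookup ℓ p) (extend p ls)

-- The test for ratio at most 1/2. It need not be strict, because `h` exceeds 2^(n-1) strictly.
sparse : ∀ {k} → List (Vec Label k) → Bool
sparse {k} ls = 2 * length ls ≤ᵇ 2 ^ k

-- The list of vertex indices holds the vertices that may still have neighbours outside the partial subtree.
-- Each of them is either closed (and dropped) or gives rise to a new vertex.
search : ℕ → ∀ {k} → List (Vec Label k) → List (Fin k) → Bool
scan   : ℕ → ∀ {k} → List (Vec Label k) → List (Fin k) → Bool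
search zero    ls act = sparse ls
search (suc f) ls act = sparse ls ∨ scan f ls act
-- Here all vertices are taken to be closed, so the subtree would be the whole of T: an order below
-- 9 contradicts the hypothesis on n, and any other order is compared with `h` directly.
scan f {k} ls []        = (k <ᵇ 9) ∨ (length ls <ᵇ h k)
scan f     ls (p ∷ act) = scan f ls act ∧ search f (extend p ls) (zero ∷ List.map suc (p ∷ act))

ls₂ : List (Vec Label 2)
ls₂ = extend zero ((out ∷ []) ∷ (free ∷ []) ∷ [])

-- Labellings list the newest vertex first; after ls₂, index 0 is a and index 1 is u, for an edge u a.
-- The first word of each name is the shape grown on the side of u, the second on the side of a.
fork-fork fork-path path-path : List (Vec Label 6)
fork-fork = extend (suc (suc (suc zero))) (extend (suc (suc zero)) (extend (suc (suc zero)) (extend (suc zero) ls₂)))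
fork-path = extend zero (extend (suc (suc zero)) (extend (suc (suc zero)) (extend (suc zero) ls₂)))
path-path = extend zero (extend (suc (suc zero)) (extend zero (extend (suc zero) ls₂)))

-- By evaluation. Fuel 5 leads from order 6 to order 11, where every branch still alive passes
-- `sparse`.
fork-fork-searched : search 5 fork-fork (List.allFin 6) ≡ true
fork-fork-searched = refl
fork-path-searched : search 5 fork-path (List.allFin 6) ≡ true
fork-path-searched = refl
path-path-searched : search 5 path-path (List.allFin 6) ≡ true
path-path-searched = refl

-- Soundness of the search

Distinct : ∀ {n k} → Vec (Fin n) k → Set
Distinct vs = Injective _≡_ _≡_ (lookup vs)

Fresh : ∀ {n k} → Fin n → Vec (Fin n) k → Set
Fresh x vs = ∀ i → ¬ lookup vs i ≡ x

injective-∷ : ∀ {n k} {x : Fin n} {vs : Vec (Fin n) k} → Fresh x vs → Distinct vs → Distinct (x ∷ vs)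
injective-∷ fresh inj {zero}  {zero}  eq = refl
injective-∷ fresh inj {zero}  {suc j} eq = contradiction (≡-sym eq) (fresh j)
injective-∷ fresh inj {suc i} {zero}  eq = contradiction eq (fresh i)
injective-∷ fresh inj {suc i} {suc j} eq = cong suc (inj eq)

occupied : Label → Bool
occupied out     = false
occupied free    = true
occupied matched = true

any-∈ : ∀ {k} {b : Vec Bool k} {bs} → b ∈ bs → any (λ c → does (≡-dec Bool._≟_ b c)) bs ≡ true
any-∈ {b = b} {_ ∷ bs} (here refl) = cong (_∨ any (λ c → does (≡-dec Bool._≟_ b c)) bs) (dec-true (≡-dec Bool._≟_ b b) refl)
any-∈ {bs = c ∷ bs} (there b∈) = trans (cong (_ ∨_) (any-∈ b∈)) (∨-zeroʳ _)

branch-⊇ : ∀ {k} (ℓ : Vec Label k) p l {rest y} → y ∈ rest → y ∈ branch ℓ p l rest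
branch-⊇ ℓ p out     y∈ = there y∈
branch-⊇ ℓ p free    y∈ = there y∈
branch-⊇ ℓ p matched y∈ = y∈

∈-extend-out : ∀ {k} (p : Fin k) {ℓ ls} → ℓ ∈ ls → (out ∷ ℓ) ∈ extend p ls
∈-extend-out p (here refl) = here refl
∈-extend-out p {ls = ℓ ∷ ls} (there ℓ∈) = there (branch-⊇ ℓ p (lookup ℓ p) (∈-extend-out p ℓ∈))

∈-extend-free : ∀ {k} (p : Fin k) {ℓ ls} → ℓ ∈ ls → lookup ℓ p ≡ out → (free ∷ ℓ) ∈ extend p ls
∈-extend-free p (here refl) eq rewrite eq = there (here refl)
∈-extend-free p {ls = ℓ ∷ ls} (there ℓ∈) eq = there (branch-⊇ ℓ p (lookup ℓ p) (∈-extend-free p ℓ∈ eq))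

∈-extend-matched : ∀ {k} (p : Fin k) {ℓ ls} → ℓ ∈ ls → lookup ℓ p ≡ free →
  (matched ∷ ℓ [ p ]≔ matched) ∈ extend p ls
∈-extend-matched p (here refl) eq rewrite eq = there (here refl)
∈-extend-matched p {ls = ℓ ∷ ls} (there ℓ∈) eq = there (branch-⊇ ℓ p (lookup ℓ p) (∈-extend-matched p ℓ∈ eq))

module _ {n} (G : Graph n) where

  -- `free` only records that the vertex is chosen. `matched` carries a witness, which is what later
  -- rules out a second chosen neighbour.
  Fits : ∀ {k} → Vec Bool n → Vec (Fin n) k → Fin n → Label → Set
  Fits S vs v out     = lookup S v ≡ false
  Fits S vs v free    = lookup S v ≡ true
  Fits S vs v matched = lookup S v ≡ true × ∃ λ i → lookup S (lookup vs i) ≡ true × Adj G v (lookup vs i)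

  Fits-occupied : ∀ {k} S (vs : Vec (Fin n) k) v l → Fits S vs v l → lookup S v ≡ occupied l
  Fits-occupied S vs v out     fit = fit
  Fits-occupied S vs v free    fit = fit
  Fits-occupied S vs v matched fit = proj₁ fit

  Fits-∷ : ∀ {k} S (vs : Vec (Fin n) k) {x} v l → Fits S vs v l → Fits S (x ∷ vs) v l
  Fits-∷ S vs v out     fit = fit
  Fits-∷ S vs v free    fit = fit
  Fits-∷ S vs v matched (Sv , i , Si , vi) = Sv , suc i , Si , vi

  Labels : ∀ {k} → Vec Bool n → Vec (Fin n) k → Vec Label k → Set
  Labels S vs ℓ = ∀ i → Fits S vs (lookup vs i) (lookup ℓ i)

  Covers : ∀ {k} → Vec (Fin n) k → List (Vec Label k) → Set
  Covers vs ls = ∀ S → Dissociated G S → ∃ λ ℓ → ℓ ∈ ls × Labels S vs ℓ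

  Covers-extend : ∀ {k} {vs : Vec (Fin n) k} {ls} p {x} → Fresh x vs → Adj G (lookup vs p) x →
    Covers vs ls → Covers (x ∷ vs) (extend p ls)
  Covers-extend {k} {vs} {ls} p {x} fresh px cov S diss with cov S diss
  ... | ℓ , ℓ∈ , lab with lookup S x in Sx
  ... | false = out ∷ ℓ , ∈-extend-out p ℓ∈ , λ { zero → Sx ; (suc i) → Fits-∷ S vs _ (lookup ℓ i) (lab i) }
  ... | true with lookup ℓ p in ℓp | lab p
  ... | out     | fit = free ∷ ℓ , ∈-extend-free p ℓ∈ ℓp , λ { zero → Sx ; (suc i) → Fits-∷ S vs _ (lookup ℓ i) (lab i) }
  -- This is the case for which `branch` adds nothing: the recorded neighbour of p and the new
  -- vertex x would both be chosen, hence equal, but x is fresh.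
  ... | matched | (Sp , i , Si , pi) = contradiction (diss _ _ _ Sp Si Sx pi px) (fresh i)
  ... | free    | Sp = matched ∷ ℓ [ p ]≔ matched , ∈-extend-matched p ℓ∈ ℓp , fits
    where
    fits : Labels S (x ∷ vs) (matched ∷ ℓ [ p ]≔ matched)
    fits zero = Sx , suc p , Sp , trans (Graph.sym G x (lookup vs p)) px
    fits (suc i) with i Fin.≟ p
    ... | yes refl = subst (Fits S (x ∷ vs) (lookup vs i)) (≡-sym (lookup∘update i ℓ matched)) (Sp , zero , Sx , px)
    ... | no i≢p = subst (Fits S (x ∷ vs) (lookup vs i)) (≡-sym (lookup∘update′ i≢p ℓ matched)) (Fits-∷ S vs _ (lookup ℓ i) (lab i))

  -- Forgetting the difference between `free` and `matched` turns each labelling into a subset of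
  -- the partial subtree, and every dissociation set of G restricts to one of these subsets.
  Covers⇒d≤ : ∀ {k} {vs : Vec (Fin n) k} {ls} → Distinct vs → Covers vs ls → d G * 2 ^ k ≤ length ls * 2 ^ n
  Covers⇒d≤ {k} {vs} {ls} inj cov = ≤-trans
    (d-restrict G (lookup vs) inj _ hit)
    (*-monoˡ-≤ (2 ^ n) (≤-trans (count-list k bs) (≤-reflexive (length-map _ ls))))
    where
    bs = List.map (Vec.map occupied) ls
    hit : ∀ S → Dissociated G S → any (λ b → does (≡-dec Bool._≟_ (restrict (lookup vs) S) b)) bs ≡ true
    hit S diss with cov S diss
    ... | ℓ , ℓ∈ , lab = any-∈ (subst (_∈ bs) (≡-sym agree) (∈-map⁺ (Vec.map occupied) ℓ∈))
      where
      agree : restrict (lookup vs) S ≡ Vec.map occupied ℓ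
      agree = lookup-ext _ _ λ i → trans (restrict-lookup (lookup vs) S i)
        (trans (Fits-occupied S vs _ _ (lab i)) (≡-sym (lookup-map i occupied ℓ)))

  record Partial {k} (vs : Vec (Fin n) k) (ls : List (Vec Label k)) : Set where
    field
      injective : Distinct vs
      covers    : Covers vs ls

  start : ∀ u → Partial (u ∷ []) ((out ∷ []) ∷ (free ∷ []) ∷ [])
  start u = record
    { injective = λ { {zero} {zero} _ → refl }
    ; covers = λ S diss → choose S }
    where
    choose : ∀ S → ∃ λ ℓ → ℓ ∈ ((out ∷ []) ∷ (free ∷ []) ∷ []) × Labels S (u ∷ []) ℓ
    choose S with lookup S u in Su
    ... | false = out ∷ [] , here refl , λ { zero → Su }
    ... | true  = free ∷ [] , there (here refl) , λ { zero → Su }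

  grow : ∀ {k} {vs : Vec (Fin n) k} {ls} p {x} → Fresh x vs → Adj G (lookup vs p) x →
    Partial vs ls → Partial (x ∷ vs) (extend p ls)
  grow {vs = vs} p fresh px part = record
    { injective = injective-∷ {vs = vs} fresh (Partial.injective part)
    ; covers    = Covers-extend p fresh px (Partial.covers part) }

  Reached : ∀ {k} → Vec (Fin n) k → Fin n → Set
  Reached vs w = ∃ λ i → lookup vs i ≡ w

  Closed : ∀ {k} → Vec (Fin n) k → Fin n → Set
  Closed vs v = ∀ w → Adj G v w → Reached vs w

  reached? : ∀ {k} (vs : Vec (Fin n) k) w → Dec (Reached vs w)
  reached? vs w = any? λ i → lookup vs i Fin.≟ w

  closed⇒reached : ∀ {k} {vs : Vec (Fin n) k} → (∀ i → Closed vs (lookup vs i)) →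
    ∀ {v w} → Walk G v w → Reached vs v → Reached vs w
  closed⇒reached      closed here         r          = r
  closed⇒reached {vs = vs} closed (there vw q) (i , refl) = closed⇒reached {vs = vs} closed q (closed i _ vw)

  closed-or-open : ∀ {k} (vs : Vec (Fin n) k) v → Closed vs v ⊎ (∃ λ x → Adj G v x × Fresh x vs)
  closed-or-open vs v with any? (λ w → (adj G v w Bool.≟ true) ×-dec ¬? (reached? vs w))
  ... | yes (x , vx , ¬r) = inj₂ (x , vx , λ i eq → ¬r (i , eq))
  ... | no none = inj₁ closed
    where
    closed : Closed vs v
    closed w vw with reached? vs w
    ... | yes r = r
    ... | no ¬r = contradiction (w , vw , ¬r) none

-- The gap that makes ratio 1/2 sufficient for a strict bound.
2^<h : ∀ n → 2 ^ (n ∸ 1) < h n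
2^<h n with isEven n
... | true  = m<m+n _ (*-mono-< (≤-trans (s≤s z≤n) (m≤n+m 12 n)) (m^n>0 2 ⌊ n ∸ 8 /2⌋))
... | false = m<m+n _ (*-mono-< (≤-trans (s≤s z≤n) (m≤n+m 9 n)) (m^n>0 2 ⌊ n ∸ 7 /2⌋))

∨-true⁻ : ∀ {a b} → a ∨ b ≡ true → a ≡ true ⊎ b ≡ true
∨-true⁻ {true}  _  = inj₁ refl
∨-true⁻ {false} eq = inj₂ eq

true⇒T : ∀ {b} → b ≡ true → T b
true⇒T refl = tt

module _ {n} (G : Graph n) (connected : Connected G) (9≤n : 9 ≤ n) where

  sparse⇒d< : ∀ {k} {vs : Vec (Fin n) k} {ls} → Partial G vs ls → sparse ls ≡ true → d G < h n
  sparse⇒d< {k} {vs} {ls} part eq = ≤-<-trans (half n 9≤n double) (2^<h n)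
    where
    double : 2 * d G ≤ 2 ^ n
    double = *-cancelʳ-≤ (2 * d G) (2 ^ n) (2 ^ k) {{m^n≢0 2 k}} (begin
      2 * d G * 2 ^ k          ≡⟨ *-assoc 2 (d G) (2 ^ k) ⟩
      2 * (d G * 2 ^ k)        ≤⟨ *-monoʳ-≤ 2 (Covers⇒d≤ G (Partial.injective part) (Partial.covers part)) ⟩
      2 * (length ls * 2 ^ n)  ≡⟨ *-assoc 2 (length ls) (2 ^ n) ⟨
      2 * length ls * 2 ^ n    ≤⟨ *-monoˡ-≤ (2 ^ n) (≤ᵇ⇒≤ (2 * length ls) (2 ^ k) (true⇒T eq)) ⟩
      2 ^ k * 2 ^ n            ≡⟨ *-comm (2 ^ k) (2 ^ n) ⟩
      2 ^ n * 2 ^ k            ∎)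
      where open ≤-Reasoning
    half : ∀ m {x} → 9 ≤ m → 2 * x ≤ 2 ^ m → x ≤ 2 ^ (m ∸ 1)
    half (suc m) _ le = *-cancelˡ-≤ 2 le

  -- The search verifies both alternatives at each vertex p, closed or with a further neighbour; the
  -- proof follows the one that G realises. Invariant: a vertex missing from `act` has all its
  -- neighbours in `vs`, which persists when `vs` grows. The argument of type `Fin k` supplies a
  -- vertex from which connectedness reaches everything once all of `vs` is closed.
  search-sound : ∀ f {k} {vs : Vec (Fin n) k} {ls act} → Fin k → Partial G vs ls →
    (∀ i → i ∈ act ⊎ Closed G vs (lookup vs i)) → search f ls act ≡ true → d G < h n
  scan-sound : ∀ f {k} {vs : Vec (Fin n) k} {ls} act → Fin k → Partial G vs ls →
    (∀ i → i ∈ act ⊎ Closed G vs (lookup vs i)) → scan f ls act ≡ true → d G < h n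
  search-sound zero    root part inv eq = sparse⇒d< part eq
  search-sound (suc f) {act = act} root part inv eq with ∨-true⁻ eq
  ... | inj₁ eq′ = sparse⇒d< part eq′
  ... | inj₂ eq′ = scan-sound f act root part inv eq′
  scan-sound f {k} {vs} {ls} [] root part inv eq = finish k≡n vs ls part eq
    where
    closed : ∀ i → Closed G vs (lookup vs i)
    closed i with inv i
    ... | inj₂ c = c
    reach : ∀ w → Reached G vs w
    reach w = closed⇒reached G {vs = vs} closed (connected (lookup vs root) w) (root , refl)
    k≡n : k ≡ n
    k≡n = ≤-antisym (injective⇒≤ (Partial.injective part))
      (injective⇒≤ {f = proj₁ ∘ reach} λ {v} {w} e →
        trans (≡-sym (proj₂ (reach v))) (trans (cong (lookup vs) e) (proj₂ (reach w))))
    finish : ∀ {k} → k ≡ n → (vs : Vec (Fin n) k) (ls : List (Vec Label k)) → Partial G vs ls →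
      scan f ls [] ≡ true → d G < h n
    finish refl vs ls part eq with ∨-true⁻ {n <ᵇ 9} eq
    ... | inj₁ small = contradiction (<ᵇ⇒< n 9 (true⇒T small)) (≤⇒≯ 9≤n)
    ... | inj₂ below = ≤-<-trans
      (*-cancelʳ-≤ (d G) (length ls) (2 ^ n) {{m^n≢0 2 n}} (Covers⇒d≤ G (Partial.injective part) (Partial.covers part)))
      (<ᵇ⇒< _ _ (true⇒T below))
  scan-sound f {k} {vs} {ls} (p ∷ act) root part inv eq with closed-or-open G vs (lookup vs p)
  ... | inj₁ closed = scan-sound f act root part inv′ (proj₁ (∧-true⁻ eq))
    where
    inv′ : ∀ i → i ∈ act ⊎ Closed G vs (lookup vs i)
    inv′ i with inv i
    ... | inj₁ (here refl) = inj₂ closed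
    ... | inj₁ (there i∈)  = inj₁ i∈
    ... | inj₂ c           = inj₂ c
  ... | inj₂ (x , px , fresh) = search-sound f zero (grow G p fresh px part) inv′ (proj₂ (∧-true⁻ {scan f ls act} eq))
    where
    inv′ : ∀ i → i ∈ (zero ∷ List.map suc (p ∷ act)) ⊎ Closed G (x ∷ vs) (lookup (x ∷ vs) i)
    inv′ zero = inj₁ (here refl)
    inv′ (suc i) with inv i
    ... | inj₁ i∈ = inj₁ (there (∈-map⁺ suc i∈))
    ... | inj₂ c  = inj₂ λ w vw → suc (proj₁ (c w vw)) , proj₂ (c w vw)

  search-all : ∀ {k} {vs : Vec (Fin n) (suc k)} {ls} f → Partial G vs ls → search f ls (List.allFin (suc k)) ≡ true → d G < h n
  search-all f part = search-sound f zero part (inj₁ ∘ ∈-allFin)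

-- Trees without a centre

lookup-unique : ∀ {A : Set} {xs : List A} → Unique xs → ∀ {i j} → List.lookup xs i ≡ List.lookup xs j → i ≡ j
lookup-unique (x∉ ∷ xs!) {zero}  {zero}  eq = refl
lookup-unique (x∉ ∷ xs!) {zero}  {suc j} eq = contradiction eq (All.lookup x∉ (∈-lookup j))
lookup-unique (x∉ ∷ xs!) {suc i} {zero}  eq = contradiction (≡-sym eq) (All.lookup x∉ (∈-lookup i))
lookup-unique (x∉ ∷ xs!) {suc i} {suc j} eq = cong suc (lookup-unique xs! eq)

unique⇒length≤ : ∀ {n} {xs : List (Fin n)} → Unique xs → length xs ≤ n
unique⇒length≤ xs! = injective⇒≤ (lookup-unique xs!)

unique-rotate : ∀ {A : Set} (xs : List A) {z ys} → Unique (xs ++ z ∷ ys) → Unique (z ∷ xs)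
unique-rotate []       _ = [] ∷ []
unique-rotate (x ∷ xs) (x∉ ∷ rest!) with unique-rotate xs rest! | ++⁻ʳ xs x∉
... | z∉ ∷ xs! | x≢z ∷ _ = ((x≢z ∘ ≡-sym) ∷ z∉) ∷ (++⁻ˡ xs x∉) ∷ xs!

linked-prefix : ∀ {A : Set} {R : A → A → Set} (xs : List A) {z ys} → Linked R (xs ++ z ∷ ys) → Linked R (xs ++ z ∷ [])
linked-prefix []            _       = [-]
linked-prefix (x ∷ [])      (r ∷ l) = r ∷ [-]
linked-prefix (x ∷ y ∷ xs)  (r ∷ l) = r ∷ linked-prefix (y ∷ xs) l

avoid : ∀ {n k} {x : Fin n} {vs : Vec (Fin n) k} → VecAll.All (λ v → ¬ v ≡ x) vs → Fresh x vs
avoid = VecAll.lookup⁺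

module _ {n} (G : Graph n) where

  -- In a tree: the component of G - u that contains a has at least 3 vertices. The third vertex
  -- hangs either on a (a fork) or on b (a path); in the latter case it differs from u, since
  -- otherwise u, a, b would form a triangle whenever u is adjacent to a.
  Heavy : Fin n → Fin n → Set
  Heavy u a = ∃ λ b → Adj G a b × ¬ b ≡ u ×
    ((∃ λ b′ → Adj G a b′ × ¬ b′ ≡ u × ¬ b′ ≡ b) ⊎ (∃ λ c → Adj G b c × ¬ c ≡ a))

  HeavyNeighbour : Fin n → Set
  HeavyNeighbour u = ∃ λ a → Adj G u a × Heavy u a

  adj? : ∀ u v → Dec (Adj G u v)
  adj? u v = adj G u v Bool.≟ true

  heavy? : ∀ u a → Dec (Heavy u a)
  heavy? u a = any? λ b → adj? a b ×-dec ¬? (b Fin.≟ u) ×-dec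
    ((any? λ b′ → adj? a b′ ×-dec ¬? (b′ Fin.≟ u) ×-dec ¬? (b′ Fin.≟ b)) ⊎-dec
     (any? λ c → adj? b c ×-dec ¬? (c Fin.≟ a)))

  heavyNeighbour? : ∀ u → Dec (HeavyNeighbour u)
  heavyNeighbour? u = any? λ a → adj? u a ×-dec heavy? u a

  adj-sym : ∀ {u v} → Adj G u v → Adj G v u
  adj-sym {u} {v} uv = trans (Graph.sym G v u) uv

  adj⇒≢ : ∀ {u v} → Adj G u v → ¬ u ≡ v
  adj⇒≢ {u} uv refl with () ← trans (≡-sym uv) (irrefl G u)

  HeavyEdge : Set
  HeavyEdge = ∃ λ u → ∃ λ a → Adj G u a × Heavy u a × Heavy a u

  module _ (acyclic : Acyclic G) where

    ¬triangle : ∀ {a b c} → Adj G a b → Adj G b c → Adj G c a → ⊥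
    ¬triangle {a} {b} {c} ab bc ca = acyclic (a , b ∷ c ∷ [] , s≤s (s≤s z≤n) ,
      (adj⇒≢ ab ∷ adj⇒≢ ca ∘ ≡-sym ∷ []) ∷ (adj⇒≢ bc ∷ []) ∷ [] ∷ [] ,
      ab ∷ bc ∷ ca ∷ [-])

    ¬square : ∀ {a b c e} → Adj G a b → Adj G b c → Adj G c e → Adj G e a → ¬ a ≡ c → ¬ b ≡ e → ⊥
    ¬square {a} {b} {c} {e} ab bc ce ea a≢c b≢e = acyclic (a , b ∷ c ∷ e ∷ [] , s≤s (s≤s z≤n) ,
      (adj⇒≢ ab ∷ a≢c ∷ adj⇒≢ ea ∘ ≡-sym ∷ []) ∷ (adj⇒≢ bc ∷ b≢e ∷ []) ∷ (adj⇒≢ ce ∷ []) ∷ [] ∷ [] ,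
      ab ∷ bc ∷ ce ∷ ea ∷ [-])

    -- A closed walk of length 5 cannot merely backtrack: if two positions at distance two coincide,
    -- the other three edges already form a triangle. In a square the opposite corners have to be
    -- kept apart by hypothesis.
    ¬pentagon : ∀ {a b c e f} → Adj G a b → Adj G b c → Adj G c e → Adj G e f → Adj G f a → ⊥
    ¬pentagon {a} {b} {c} {e} {f} ab bc ce ef fa = acyclic (a , b ∷ c ∷ e ∷ f ∷ [] , s≤s (s≤s z≤n) ,
      (adj⇒≢ ab ∷ (λ { refl → ¬triangle ce ef fa }) ∷ (λ { refl → ¬triangle ab bc ce }) ∷ adj⇒≢ fa ∘ ≡-sym ∷ []) ∷
      (adj⇒≢ bc ∷ (λ { refl → ¬triangle ef fa ab }) ∷ (λ { refl → ¬triangle bc ce ef }) ∷ []) ∷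
      (adj⇒≢ ce ∷ (λ { refl → ¬triangle fa ab bc }) ∷ []) ∷ (adj⇒≢ ef ∷ []) ∷ [] ∷ [] ,
      ab ∷ bc ∷ ce ∷ ef ∷ fa ∷ [-])

    -- Keep walking towards a heavy neighbour: acyclicity and finiteness force the walk to turn back, and it
    -- does so along an edge heavy on both sides.
    heavy-walk : (∀ u → HeavyNeighbour u) → ∀ fuel {x y} xs → n < fuel + length (x ∷ y ∷ xs) →
      Unique (x ∷ y ∷ xs) → Linked (Adj G) (x ∷ y ∷ xs) → Heavy y x → HeavyEdge
    heavy-walk next zero xs long uniq linked heavy = contradiction (unique⇒length≤ uniq) (<⇒≱ long)
    heavy-walk next (suc fuel) {x} {y} xs long uniq linked@(xy ∷ _) heavy with next x
    ... | z , xz , heavy′ with z Fin.≟ y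
    ... | yes refl = y , x , adj-sym xy , heavy , heavy′
    ... | no z≢y with member? Fin._≟_ z xs
    ... | no z∉ = heavy-walk next fuel (y ∷ xs) (subst (n <_) (≡-sym (+-suc fuel _)) long)
            ((adj⇒≢ xz ∘ ≡-sym ∷ z≢y ∷ ¬Any⇒All¬ _ z∉) ∷ uniq) (adj-sym xz ∷ linked) heavy′
    -- The list is newest first, so the stretch from the earlier visit of z up to x closes up into a
    -- cycle, of length at least 3 because x and y both lie on it.
    ... | yes z∈ with ∈-∃++ z∈
    ... | ys , zs , refl = contradiction
      (z , x ∷ y ∷ ys , s≤s (s≤s z≤n) , unique-rotate (x ∷ y ∷ ys) uniq , adj-sym xz ∷ linked-prefix (x ∷ y ∷ ys) linked)
      acyclic

    heavyEdge : Fin n → (∀ u → HeavyNeighbour u) → HeavyEdge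
    heavyEdge u next with next u
    ... | a , ua , heavy = heavy-walk next n [] (m<m+n n (s≤s z≤n))
      ((adj⇒≢ ua ∘ ≡-sym ∷ []) ∷ [] ∷ []) (adj-sym ua ∷ [-]) heavy

module _ {n} (G : Graph n) (tree : IsTree G) (9≤n : 9 ≤ n) where
  private
    connected = proj₁ tree
    acyclic = proj₂ tree
    infix 4 _~_
    _~_ = Adj G
    flip : ∀ {u v} → u ~ v → v ~ u
    flip = adj-sym G
    ≠ : ∀ {u v} → u ~ v → ¬ u ≡ v
    ≠ = adj⇒≢ G
    △ : ∀ {a b c} → a ~ b → b ~ c → c ~ a → ⊥
    △ = ¬triangle G acyclic

  -- The work in this and the next two lemmas is freshness: two vertices on opposite sides of the
  -- edge u a that coincided would close a cycle, of length 3 here, up to 4 for `fork-path-d<` and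
  -- up to 5 for `path-path-d<`.
  fork-fork-d< : ∀ {u a b b′ c c′} → u ~ a → a ~ b → ¬ b ≡ u → a ~ b′ → ¬ b′ ≡ u → ¬ b′ ≡ b →
    u ~ c → ¬ c ≡ a → u ~ c′ → ¬ c′ ≡ a → ¬ c′ ≡ c → d G < h n
  fork-fork-d< {u} {a} {b} {b′} {c} {c′} ua ab b≢u ab′ b′≢u b′≢b uc c≢a uc′ c′≢a c′≢c =
    search-all G connected 9≤n 5 six fork-fork-searched
    where
    two = grow G zero {a} (avoid (≠ ua ∷ [])) ua (start G u)
    three = grow G (suc zero) {c} (avoid (c≢a ∘ ≡-sym ∷ ≠ uc ∷ [])) uc two
    four = grow G (suc (suc zero)) {c′} (avoid (c′≢c ∘ ≡-sym ∷ c′≢a ∘ ≡-sym ∷ ≠ uc′ ∷ [])) uc′ three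
    five = grow G (suc (suc zero)) {b} (avoid ((λ { refl → △ ua ab (flip uc′) }) ∷ (λ { refl → △ ua ab (flip uc) }) ∷ ≠ ab ∷ b≢u ∘ ≡-sym ∷ [])) ab four
    six = grow G (suc (suc (suc zero))) {b′} (avoid (b′≢b ∘ ≡-sym ∷ (λ { refl → △ ua ab′ (flip uc′) }) ∷ (λ { refl → △ ua ab′ (flip uc) }) ∷ ≠ ab′ ∷ b′≢u ∘ ≡-sym ∷ [])) ab′ five

  fork-path-d< : ∀ {u a b e c c′} → u ~ a → a ~ b → ¬ b ≡ u → b ~ e → ¬ e ≡ a →
    u ~ c → ¬ c ≡ a → u ~ c′ → ¬ c′ ≡ a → ¬ c′ ≡ c → d G < h n
  fork-path-d< {u} {a} {b} {e} {c} {c′} ua ab b≢u be e≢a uc c≢a uc′ c′≢a c′≢c =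
    search-all G connected 9≤n 5 six fork-path-searched
    where
    two = grow G zero {a} (avoid (≠ ua ∷ [])) ua (start G u)
    three = grow G (suc zero) {c} (avoid (c≢a ∘ ≡-sym ∷ ≠ uc ∷ [])) uc two
    four = grow G (suc (suc zero)) {c′} (avoid (c′≢c ∘ ≡-sym ∷ c′≢a ∘ ≡-sym ∷ ≠ uc′ ∷ [])) uc′ three
    five = grow G (suc (suc zero)) {b} (avoid ((λ { refl → △ ua ab (flip uc′) }) ∷ (λ { refl → △ ua ab (flip uc) }) ∷ ≠ ab ∷ b≢u ∘ ≡-sym ∷ [])) ab four
    off : ∀ {x} → u ~ x → ¬ x ≡ a → ¬ x ≡ e
    off ux x≢a refl = ¬square G acyclic ua ab be (flip ux) (b≢u ∘ ≡-sym) (x≢a ∘ ≡-sym)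
    six = grow G zero {e} (avoid (≠ be ∷ off uc′ c′≢a ∷ off uc c≢a ∷ e≢a ∘ ≡-sym ∷ (λ { refl → △ ua ab be }) ∷ [])) be five

  path-path-d< : ∀ {u a b e c f} → u ~ a → a ~ b → ¬ b ≡ u → b ~ e → ¬ e ≡ a →
    u ~ c → ¬ c ≡ a → c ~ f → ¬ f ≡ u → d G < h n
  path-path-d< {u} {a} {b} {e} {c} {f} ua ab b≢u be e≢a uc c≢a cf f≢u =
    search-all G connected 9≤n 5 six path-path-searched
    where
    two = grow G zero {a} (avoid (≠ ua ∷ [])) ua (start G u)
    three = grow G (suc zero) {c} (avoid (c≢a ∘ ≡-sym ∷ ≠ uc ∷ [])) uc two
    four = grow G zero {f} (avoid (≠ cf ∷ (λ { refl → △ ua (flip cf) (flip uc) }) ∷ f≢u ∘ ≡-sym ∷ [])) cf three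
    five = grow G (suc (suc zero)) {b} (avoid ((λ { refl → ¬square G acyclic ua ab (flip cf) (flip uc) (b≢u ∘ ≡-sym) (c≢a ∘ ≡-sym) }) ∷ (λ { refl → △ ua ab (flip uc) }) ∷ ≠ ab ∷ b≢u ∘ ≡-sym ∷ [])) ab four
    six = grow G zero {e} (avoid (≠ be ∷ (λ { refl → ¬pentagon G acyclic ua ab be (flip cf) (flip uc) }) ∷ (λ { refl → ¬square G acyclic ua ab be (flip uc) (b≢u ∘ ≡-sym) (c≢a ∘ ≡-sym) }) ∷ e≢a ∘ ≡-sym ∷ (λ { refl → △ ua ab be }) ∷ [])) be five

  heavyEdge⇒d< : HeavyEdge G → d G < h n
  heavyEdge⇒d< (u , a , ua , (b , ab , b≢u , inj₁ (b′ , ab′ , b′≢u , b′≢b)) , (c , uc , c≢a , inj₁ (c′ , uc′ , c′≢a , c′≢c))) =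
    fork-fork-d< ua ab b≢u ab′ b′≢u b′≢b uc c≢a uc′ c′≢a c′≢c
  heavyEdge⇒d< (u , a , ua , (b , ab , b≢u , inj₂ (e , be , e≢a)) , (c , uc , c≢a , inj₁ (c′ , uc′ , c′≢a , c′≢c))) =
    fork-path-d< ua ab b≢u be e≢a uc c≢a uc′ c′≢a c′≢c
  -- A path at u and a fork at a: reading the edge backwards reduces this to the previous case, so
  -- three shapes suffice for four combinations.
  heavyEdge⇒d< (u , a , ua , (b , ab , b≢u , inj₁ (b′ , ab′ , b′≢u , b′≢b)) , (c , uc , c≢a , inj₂ (f , cf , f≢u))) =
    fork-path-d< (flip ua) uc c≢a cf f≢u ab b≢u ab′ b′≢u b′≢b
  heavyEdge⇒d< (u , a , ua , (b , ab , b≢u , inj₂ (e , be , e≢a)) , (c , uc , c≢a , inj₂ (f , cf , f≢u))) =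
    path-path-d< ua ab b≢u be e≢a uc c≢a cf f≢u

  light-vertex-or-d< : (∃ λ u → ¬ HeavyNeighbour G u) ⊎ d G < h n
  light-vertex-or-d< with any? (λ u → ¬? (heavyNeighbour? G u))
  ... | yes light = inj₁ light
  ... | no  none  = inj₂ (heavyEdge⇒d< (heavyEdge G acyclic (vertex 9≤n)
      λ u → decidable-stable (heavyNeighbour? G u) λ ¬heavy → none (u , ¬heavy)))
    where
    vertex : ∀ {m} → 9 ≤ m → Fin m
    vertex (s≤s _) = zero

-- Spiders

-- The two possible components K₁ and K₂ of the tree minus its centre. A list of legs thus encodes
-- the right operand of K₁ * H, and vertices are numbered leg by leg after the centre, each foot
-- before its mate.
data Leg : Set where
  short long : Leg

size : List Leg → ℕ
size []           = 0
size (short ∷ ks) = suc (size ks)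
size (long ∷ ks)  = suc (suc (size ks))

foot : ∀ ks → Fin (size ks) → Bool
foot (short ∷ ks) zero          = true
foot (short ∷ ks) (suc i)       = foot ks i
foot (long ∷ ks)  zero          = true
foot (long ∷ ks)  (suc zero)    = false
foot (long ∷ ks)  (suc (suc i)) = foot ks i

mate : ∀ ks → Fin (size ks) → Fin (size ks) → Bool
mate (short ∷ ks) zero          _             = false
mate (short ∷ ks) (suc i)       zero          = false
mate (short ∷ ks) (suc i)       (suc j)       = mate ks i j
mate (long ∷ ks)  zero          zero          = false
mate (long ∷ ks)  zero          (suc zero)    = true
mate (long ∷ ks)  zero          (suc (suc j)) = false
mate (long ∷ ks)  (suc zero)    zero          = true
mate (long ∷ ks)  (suc zero)    (suc j)       = false
mate (long ∷ ks)  (suc (suc i)) zero          = false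
mate (long ∷ ks)  (suc (suc i)) (suc zero)    = false
mate (long ∷ ks)  (suc (suc i)) (suc (suc j)) = mate ks i j

mate-sym : ∀ ks i j → mate ks i j ≡ mate ks j i
mate-sym (short ∷ ks) zero          zero          = refl
mate-sym (short ∷ ks) zero          (suc j)       = refl
mate-sym (short ∷ ks) (suc i)       zero          = refl
mate-sym (short ∷ ks) (suc i)       (suc j)       = mate-sym ks i j
mate-sym (long ∷ ks)  zero          zero          = refl
mate-sym (long ∷ ks)  zero          (suc zero)    = refl
mate-sym (long ∷ ks)  zero          (suc (suc j)) = refl
mate-sym (long ∷ ks)  (suc zero)    zero          = refl
mate-sym (long ∷ ks)  (suc zero)    (suc zero)    = refl
mate-sym (long ∷ ks)  (suc zero)    (suc (suc j)) = refl
mate-sym (long ∷ ks)  (suc (suc i)) zero          = refl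
mate-sym (long ∷ ks)  (suc (suc i)) (suc zero)    = refl
mate-sym (long ∷ ks)  (suc (suc i)) (suc (suc j)) = mate-sym ks i j

mate-irrefl : ∀ ks i → mate ks i i ≡ false
mate-irrefl (short ∷ ks) zero          = refl
mate-irrefl (short ∷ ks) (suc i)       = mate-irrefl ks i
mate-irrefl (long ∷ ks)  zero          = refl
mate-irrefl (long ∷ ks)  (suc zero)    = refl
mate-irrefl (long ∷ ks)  (suc (suc i)) = mate-irrefl ks i

mate-unique : ∀ ks i j k → mate ks i j ≡ true → mate ks i k ≡ true → j ≡ k
mate-unique (short ∷ ks) (suc i)       (suc j)       (suc k)       p q = cong suc (mate-unique ks i j k p q)
mate-unique (long ∷ ks)  zero          (suc zero)    (suc zero)    p q = refl
mate-unique (long ∷ ks)  (suc zero)    zero          zero          p q = refl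
mate-unique (long ∷ ks)  (suc (suc i)) (suc (suc j)) (suc (suc k)) p q = cong (λ x → suc (suc x)) (mate-unique ks i j k p q)

spiderAdj : ∀ ks → Fin (suc (size ks)) → Fin (suc (size ks)) → Bool
spiderAdj ks zero    zero    = false
spiderAdj ks zero    (suc j) = foot ks j
spiderAdj ks (suc i) zero    = foot ks i
spiderAdj ks (suc i) (suc j) = mate ks i j

spider : ∀ ks → Graph (suc (size ks))
spider ks = record
  { adj    = spiderAdj ks
  ; sym    = λ { zero zero → refl ; zero (suc j) → refl ; (suc i) zero → refl ; (suc i) (suc j) → mate-sym ks i j }
  ; irrefl = λ { zero → refl ; (suc i) → mate-irrefl ks i } }

-- In a dissociation set containing the centre, at most one foot occurs, and then without its mate.

clear : ∀ ks → Vec Bool (size ks) → Bool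
clear []           S           = true
clear (short ∷ ks) (b ∷ S)     = not b ∧ clear ks S
clear (long ∷ ks)  (b ∷ c ∷ S) = not b ∧ clear ks S

single : ∀ ks → Vec Bool (size ks) → Bool
single []           S           = true
single (short ∷ ks) (b ∷ S)     = if b then clear ks S else single ks S
single (long ∷ ks)  (b ∷ c ∷ S) = if b then not c ∧ clear ks S else single ks S

-- Without the centre only components of order at most 2 remain, so every subset qualifies; this is
-- the source of the term 2^(n-1) in `h`.
spiderSet : ∀ ks → Vec Bool (suc (size ks)) → Bool
spiderSet ks (b ∷ S) = if b then single ks S else true

Clear : ∀ ks → Vec Bool (size ks) → Set
Clear ks S = ∀ i → foot ks i ≡ true → ¬ lookup S i ≡ true

-- Intermediate between the recursive `single`, which can be counted, and `Dissociated`, which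
-- speaks of arbitrary vertices.
record Single ks (S : Vec Bool (size ks)) : Set where
  field
    one-foot : ∀ i j → foot ks i ≡ true → foot ks j ≡ true → lookup S i ≡ true → lookup S j ≡ true → i ≡ j
    no-mate  : ∀ i j → foot ks i ≡ true → lookup S i ≡ true → mate ks i j ≡ true → ¬ lookup S j ≡ true
open Single

clear⇒Clear : ∀ ks S → clear ks S ≡ true → Clear ks S
clear⇒Clear (short ∷ ks) (false ∷ S)     eq (suc i)       fi Si = clear⇒Clear ks S eq i fi Si
clear⇒Clear (long ∷ ks)  (false ∷ c ∷ S) eq (suc (suc i)) fi Si = clear⇒Clear ks S eq i fi Si

Clear⇒clear : ∀ ks S → Clear ks S → clear ks S ≡ true
Clear⇒clear []           S               cl = refl
Clear⇒clear (short ∷ ks) (true ∷ S)      cl = contradiction refl (cl zero refl)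
Clear⇒clear (short ∷ ks) (false ∷ S)     cl = Clear⇒clear ks S (cl ∘ suc)
Clear⇒clear (long ∷ ks)  (true ∷ c ∷ S)  cl = contradiction refl (cl zero refl)
Clear⇒clear (long ∷ ks)  (false ∷ c ∷ S) cl = Clear⇒clear ks S (λ i → cl (suc (suc i)))

single⇒Single : ∀ ks S → single ks S ≡ true → Single ks S
single⇒Single [] S eq = record { one-foot = λ () ; no-mate = λ () }
single⇒Single (short ∷ ks) (true ∷ S) eq = record
  { one-foot = λ { zero zero _ _ _ _ → refl
                 ; zero (suc j) _ fj _ Sj → contradiction Sj (cl j fj)
                 ; (suc i) _ fi _ Si _ → contradiction Si (cl i fi) }
  ; no-mate = λ { zero j _ _ () ; (suc i) j fi Si _ → contradiction Si (cl i fi) } }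
  where cl = clear⇒Clear ks S eq
single⇒Single (short ∷ ks) (false ∷ S) eq = record
  { one-foot = λ { (suc i) (suc j) fi fj Si Sj → cong suc (one-foot rec i j fi fj Si Sj) }
  ; no-mate = λ { (suc i) (suc j) fi Si ij → no-mate rec i j fi Si ij } }
  where rec = single⇒Single ks S eq
single⇒Single (long ∷ ks) (true ∷ false ∷ S) eq = record
  { one-foot = λ { zero zero _ _ _ _ → refl
                 ; zero (suc zero) _ () _ _
                 ; zero (suc (suc j)) _ fj _ Sj → contradiction Sj (cl j fj)
                 ; (suc zero) _ () _ _ _
                 ; (suc (suc i)) _ fi _ Si _ → contradiction Si (cl i fi) }
  ; no-mate = λ { zero (suc zero) _ _ _ () ; (suc (suc i)) j fi Si _ → contradiction Si (cl i fi) } }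
  where cl = clear⇒Clear ks S eq
single⇒Single (long ∷ ks) (false ∷ c ∷ S) eq = record
  { one-foot = λ { (suc (suc i)) (suc (suc j)) fi fj Si Sj → cong (λ x → suc (suc x)) (one-foot rec i j fi fj Si Sj)
                 ; (suc zero) _ () _ _ _
                 ; (suc (suc i)) (suc zero) _ () _ _ }
  ; no-mate = λ { (suc zero) _ () _ _ ; (suc (suc i)) (suc (suc j)) fi Si ij → no-mate rec i j fi Si ij } }
  where rec = single⇒Single ks S eq

Single⇒single : ∀ ks S → Single ks S → single ks S ≡ true
Single⇒single [] S s = refl
Single⇒single (short ∷ ks) (true ∷ S) s = Clear⇒clear ks S λ i fi Si →
  contradiction (one-foot s zero (suc i) refl fi refl Si) λ ()
Single⇒single (short ∷ ks) (false ∷ S) s = Single⇒single ks S record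
  { one-foot = λ i j fi fj Si Sj → suc-injective (one-foot s (suc i) (suc j) fi fj Si Sj)
  ; no-mate = λ i j → no-mate s (suc i) (suc j) }
Single⇒single (long ∷ ks) (true ∷ true ∷ S) s = contradiction refl (no-mate s zero (suc zero) refl refl refl)
Single⇒single (long ∷ ks) (true ∷ false ∷ S) s = Clear⇒clear ks S λ i fi Si →
  contradiction (one-foot s zero (suc (suc i)) refl fi refl Si) λ ()
Single⇒single (long ∷ ks) (false ∷ c ∷ S) s = Single⇒single ks S record
  { one-foot = λ i j fi fj Si Sj → suc-injective (suc-injective (one-foot s (suc (suc i)) (suc (suc j)) fi fj Si Sj))
  ; no-mate = λ i j → no-mate s (suc (suc i)) (suc (suc j)) }

spiderSet⇒dissociated : ∀ ks S → spiderSet ks S ≡ true → Dissociated (spider ks) S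
spiderSet⇒dissociated ks (b ∷ S) eq (suc i) (suc j) (suc k) Sv Sx Sy ij ik = cong suc (mate-unique ks i j k ij ik)
spiderSet⇒dissociated ks (b ∷ S) eq (suc i) zero zero Sv Sx Sy vx vy = refl
spiderSet⇒dissociated ks (true ∷ S) eq (suc i) zero (suc k) Sv Sx Sy fi ik =
  contradiction Sy (no-mate (single⇒Single ks S eq) i k fi Sv ik)
spiderSet⇒dissociated ks (true ∷ S) eq (suc i) (suc j) zero Sv Sx Sy ij fi =
  contradiction Sx (no-mate (single⇒Single ks S eq) i j fi Sv ij)
spiderSet⇒dissociated ks (true ∷ S) eq zero (suc j) (suc k) Sv Sx Sy fj fk =
  cong suc (one-foot (single⇒Single ks S eq) j k fj fk Sx Sy)

dissociated⇒spiderSet : ∀ ks S → Dissociated (spider ks) S → spiderSet ks S ≡ true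
dissociated⇒spiderSet ks (false ∷ S) diss = refl
dissociated⇒spiderSet ks (true ∷ S)  diss = Single⇒single ks S record
  { one-foot = λ i j fi fj Si Sj → suc-injective (diss zero (suc i) (suc j) refl Si Sj fi fj)
  ; no-mate = λ i j fi Si ij Sj → contradiction (diss (suc i) zero (suc j) Si refl Sj fi ij) λ () }

-- Number of dissociation sets of a spider, and its value in terms of h

d-spider : ∀ ks → d (spider ks) ≡ count (size ks) (single ks) + 2 ^ size ks
d-spider ks = begin
  d (spider ks)
    ≡⟨ d≡count (spider ks) ⟩
  count (suc (size ks)) (does ∘ isDissociation? (spider ks))
    ≡⟨ ≤-antisym (count-mono (suc (size ks)) λ S eq → dissociated⇒spiderSet ks S (does⇒dissociated (spider ks) S eq))
                 (count-mono (suc (size ks)) λ S eq → dissociated⇒does (spider ks) S (spiderSet⇒dissociated ks S eq)) ⟩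
  count (size ks) (single ks) + count (size ks) (λ _ → true)
    ≡⟨ cong (count (size ks) (single ks) +_) (count-true (size ks)) ⟩
  count (size ks) (single ks) + 2 ^ size ks ∎
  where open ≡-Reasoning

legs : ℕ → ℕ → List Leg
legs a b = replicate a short ++ replicate b long

size-legs : ∀ a b → size (legs a b) ≡ a + b * 2
size-legs zero    zero    = refl
size-legs zero    (suc b) = cong (λ x → suc (suc x)) (size-legs zero b)
size-legs (suc a) b       = cong suc (size-legs a b)

-- With all feet left out, exactly the far ends of the b long legs are free.
count-clear : ∀ a b → count (size (legs a b)) (clear (legs a b)) ≡ 2 ^ b
count-clear zero zero = refl
count-clear zero (suc b) = trans
  (cong₂ _+_ (cong₂ _+_ (count-false (size (legs 0 b))) (count-false (size (legs 0 b)))) (cong₂ _+_ (count-clear zero b) (count-clear zero b)))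
  (cong (2 ^ b +_) (≡-sym (+-identityʳ _)))
count-clear (suc a) b = cong₂ _+_ (count-false (size (legs a b))) (count-clear a b)

-- No foot gives 2^b sets, each short foot another 2^b, and each long foot 2^(b-1) since its own
-- mate is excluded. The factor 2 clears the half.
double-count-single : ∀ a b → 2 * count (size (legs a b)) (single (legs a b)) ≡ (2 * a + b + 2) * 2 ^ b
double-count-single zero zero = refl
double-count-single zero (suc b) = begin
  2 * (count N (λ _ → false) + count N (clear ks) + (count N (single ks) + count N (single ks)))
    ≡⟨ cong₂ (λ x y → 2 * (x + y + (s + s))) (count-false N) (count-clear zero b) ⟩
  2 * (2 ^ b + (s + s))
    ≡⟨ solve 2 (λ p s → con 2 :* (p :+ (s :+ s)) := con 2 :* p :+ con 2 :* (con 2 :* s)) refl (2 ^ b) s ⟩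
  2 * 2 ^ b + 2 * (2 * s)
    ≡⟨ cong (λ x → 2 * 2 ^ b + 2 * x) (double-count-single zero b) ⟩
  2 * 2 ^ b + 2 * ((b + 2) * 2 ^ b)
    ≡⟨ solve 2 (λ p b → con 2 :* p :+ con 2 :* ((b :+ con 2) :* p) := (con 1 :+ b :+ con 2) :* (con 2 :* p)) refl (2 ^ b) b ⟩
  (suc b + 2) * (2 * 2 ^ b) ∎
  where
  open ≡-Reasoning
  open +-*-Solver
  ks = legs 0 b
  N = size ks
  s = count N (single ks)
double-count-single (suc a) b = begin
  2 * (count N (clear ks) + count N (single ks))
    ≡⟨ *-distribˡ-+ 2 (count N (clear ks)) _ ⟩
  2 * count N (clear ks) + 2 * count N (single ks)
    ≡⟨ cong₂ _+_ (cong (2 *_) (count-clear a b)) (double-count-single a b) ⟩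
  2 * 2 ^ b + (2 * a + b + 2) * 2 ^ b
    ≡⟨ solve 3 (λ p a b → con 2 :* p :+ (con 2 :* a :+ b :+ con 2) :* p := (con 2 :* (con 1 :+ a) :+ b :+ con 2) :* p) refl (2 ^ b) a b ⟩
  (2 * suc a + b + 2) * 2 ^ b ∎
  where
  open ≡-Reasoning
  open +-*-Solver
  ks = legs a b
  N = size ks

double-d-spider : ∀ a b → 2 * d (spider (legs a b)) ≡ (2 * a + b + 2) * 2 ^ b + 2 ^ suc (a + b * 2)
double-d-spider a b = begin
  2 * d (spider (legs a b))
    ≡⟨ cong (2 *_) (d-spider (legs a b)) ⟩
  2 * (count (size (legs a b)) (single (legs a b)) + 2 ^ size (legs a b))
    ≡⟨ *-distribˡ-+ 2 (count (size (legs a b)) (single (legs a b))) _ ⟩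
  2 * count (size (legs a b)) (single (legs a b)) + 2 * 2 ^ size (legs a b)
    ≡⟨ cong₂ _+_ (double-count-single a b) (cong (λ x → 2 * 2 ^ x) (size-legs a b)) ⟩
  (2 * a + b + 2) * 2 ^ b + 2 ^ suc (a + b * 2) ∎
  where open ≡-Reasoning

isEven-2* : ∀ b → isEven (b * 2) ≡ true
isEven-2* zero    = refl
isEven-2* (suc b) = isEven-2* b

isEven-1+2* : ∀ b → isEven (1 + b * 2) ≡ false
isEven-1+2* zero    = refl
isEven-1+2* (suc b) = isEven-1+2* b

⌊2*/2⌋ : ∀ b → ⌊ b * 2 /2⌋ ≡ b
⌊2*/2⌋ zero    = refl
⌊2*/2⌋ (suc b) = cong suc (⌊2*/2⌋ b)

-- With 2 + b long legs the order is 7 + 2b (below, 8 + 2b), so the truncated subtraction in `h` is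
-- exact and the exponent is b.
h-odd : ∀ b → h (3 + (2 + b) * 2) ≡ 2 ^ (2 + (2 + b) * 2) + (3 + (2 + b) * 2 + 9) * 2 ^ b
h-odd b rewrite isEven-1+2* b | ⌊2*/2⌋ b = refl

h-even : ∀ b → h (4 + (2 + b) * 2) ≡ 2 ^ (3 + (2 + b) * 2) + (4 + (2 + b) * 2 + 12) * 2 ^ b
h-even b rewrite isEven-2* b | ⌊2*/2⌋ b = refl

d-spider-2 : ∀ b → d (spider (legs 2 (2 + b))) ≡ h (suc (size (legs 2 (2 + b))))
d-spider-2 b = *-cancelˡ-≡ _ _ 2 (begin
  2 * d (spider (legs 2 (2 + b)))
    ≡⟨ double-d-spider 2 (2 + b) ⟩
  (4 + (2 + b) + 2) * 2 ^ (2 + b) + 2 * X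
    ≡⟨ solve 3 (λ p b x → (con 4 :+ (con 2 :+ b) :+ con 2) :* (con 2 :* (con 2 :* p)) :+ con 2 :* x :=
         con 2 :* (x :+ (con 3 :+ (con 2 :+ b) :* con 2 :+ con 9) :* p)) refl (2 ^ b) b X ⟩
  2 * (X + (3 + (2 + b) * 2 + 9) * 2 ^ b)
    ≡⟨ cong (2 *_) (h-odd b) ⟨
  2 * h (3 + (2 + b) * 2)
    ≡⟨ cong (λ x → 2 * h (suc x)) (size-legs 2 (2 + b)) ⟨
  2 * h (suc (size (legs 2 (2 + b)))) ∎)
  where
  open ≡-Reasoning
  open +-*-Solver
  X = 2 ^ (2 + (2 + b) * 2)

d-spider-3 : ∀ b → d (spider (legs 3 (2 + b))) ≡ h (suc (size (legs 3 (2 + b))))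
d-spider-3 b = *-cancelˡ-≡ _ _ 2 (begin
  2 * d (spider (legs 3 (2 + b)))
    ≡⟨ double-d-spider 3 (2 + b) ⟩
  (6 + (2 + b) + 2) * 2 ^ (2 + b) + 2 * X
    ≡⟨ solve 3 (λ p b x → (con 6 :+ (con 2 :+ b) :+ con 2) :* (con 2 :* (con 2 :* p)) :+ con 2 :* x :=
         con 2 :* (x :+ (con 4 :+ (con 2 :+ b) :* con 2 :+ con 12) :* p)) refl (2 ^ b) b X ⟩
  2 * (X + (4 + (2 + b) * 2 + 12) * 2 ^ b)
    ≡⟨ cong (2 *_) (h-even b) ⟨
  2 * h (4 + (2 + b) * 2)
    ≡⟨ cong (λ x → 2 * h (suc x)) (size-legs 3 (2 + b)) ⟨
  2 * h (suc (size (legs 3 (2 + b)))) ∎)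
  where
  open ≡-Reasoning
  open +-*-Solver
  X = 2 ^ (3 + (2 + b) * 2)

size-exchange : ∀ a b → size (legs a (suc b)) ≡ size (legs (2 + a) b)
size-exchange a b = begin
  size (legs a (suc b)) ≡⟨ size-legs a (suc b) ⟩
  a + (2 + b * 2)       ≡⟨ solve 2 (λ a b → a :+ (con 2 :+ b :* con 2) := con 2 :+ a :+ b :* con 2) refl a b ⟩
  2 + a + b * 2         ≡⟨ size-legs (2 + a) b ⟨
  size (legs (2 + a) b) ∎
  where
  open ≡-Reasoning
  open +-*-Solver

-- Doubled, the gain is (2 + 2a + b) 2^b. The trade starts from at least three short legs because
-- from two it may gain nothing: `legs 2 0` and `legs 0 1` both give the path on 3 vertices.
exchange-< : ∀ a b → d (spider (legs (3 + a) b)) < d (spider (legs (1 + a) (suc b)))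
exchange-< a b = *-cancelˡ-< 2 _ _ (begin-strict
  2 * d (spider (legs (3 + a) b))
    ≡⟨ double-d-spider (3 + a) b ⟩
  (2 * (3 + a) + b + 2) * 2 ^ b + 2 ^ suc (3 + a + b * 2)
    ≡⟨ cong (λ x → (2 * (3 + a) + b + 2) * 2 ^ b + 2 ^ suc x) (solve 2 (λ a b → con 3 :+ a :+ b :* con 2 := con 1 :+ a :+ (con 2 :+ b :* con 2)) refl a b) ⟩
  (2 * (3 + a) + b + 2) * 2 ^ b + X
    <⟨ +-monoˡ-< X (m<m+n ((2 * (3 + a) + b + 2) * 2 ^ b) (≤-trans (m^n>0 2 b) (m≤m*n (2 ^ b) (2 + (2 * a + b))))) ⟩
  (2 * (3 + a) + b + 2) * 2 ^ b + 2 ^ b * (2 + (2 * a + b)) + X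
    ≡⟨ cong (_+ X) (solve 3 (λ a b p → (con 2 :* (con 3 :+ a) :+ b :+ con 2) :* p :+ p :* (con 2 :+ (con 2 :* a :+ b)) := (con 2 :* (con 1 :+ a) :+ (con 1 :+ b) :+ con 2) :* (con 2 :* p)) refl a b (2 ^ b)) ⟩
  (2 * (1 + a) + suc b + 2) * 2 ^ suc b + X
    ≡⟨ double-d-spider (1 + a) (suc b) ⟨
  2 * d (spider (legs (1 + a) (suc b))) ∎)
  where
  open ≤-Reasoning
  open +-*-Solver
  X = 2 ^ suc (1 + a + suc b * 2)

-- F and Tn as spiders

isEven-suc : ∀ y → isEven (suc y) ≡ not (isEven y)
isEven-suc zero          = refl
isEven-suc (suc zero)    = refl
isEven-suc (suc (suc y)) = isEven-suc y

isEven-size : ∀ b → isEven (size (legs 0 b)) ≡ true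
isEven-size zero    = refl
isEven-size (suc b) = isEven-size b

isEven-suc-size : ∀ b → isEven (suc (size (legs 0 b))) ≡ false
isEven-suc-size zero    = refl
isEven-suc-size (suc b) = isEven-suc-size b

foot-tail : ∀ b (p : Fin (size (legs 0 b))) → foot (legs 0 b) p ≡ isEven (toℕ p)
foot-tail (suc b) zero          = refl
foot-tail (suc b) (suc zero)    = refl
foot-tail (suc b) (suc (suc p)) = foot-tail b p

-- Adjacency in `fromRel` written on vertex numbers, so that the initial vertices can be split off
-- by arithmetic.
symm : (ℕ → ℕ → Bool) → ℕ → ℕ → Bool
symm R x y = not (x ≡ᵇ y) ∧ (R x y ∨ R y x)

-- The edges inside long legs, numbered from the first long leg: feet are even, and each odd number
-- is the far end belonging to its predecessor.
successive : ℕ → ℕ → Bool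
successive x y = not (isEven y) ∧ (suc x ≡ᵇ y)

odd∧zero : ∀ y → not (isEven y) ∧ (0 ≡ᵇ y) ≡ false
odd∧zero zero    = refl
odd∧zero (suc y) = ∧-zeroʳ _

mate-tail : ∀ b (p q : Fin (size (legs 0 b))) → mate (legs 0 b) p q ≡ symm successive (toℕ p) (toℕ q)
mate-tail (suc b) zero          zero          = refl
mate-tail (suc b) zero          (suc zero)    = refl
mate-tail (suc b) zero          (suc (suc q)) rewrite ∧-zeroʳ (not (isEven (toℕ q))) = refl
mate-tail (suc b) (suc zero)    zero          = refl
mate-tail (suc b) (suc zero)    (suc zero)    = refl
mate-tail (suc b) (suc zero)    (suc (suc q)) rewrite odd∧zero (toℕ q) = refl
mate-tail (suc b) (suc (suc p)) zero          rewrite ∧-zeroʳ (not (isEven (toℕ p))) = refl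
mate-tail (suc b) (suc (suc p)) (suc zero)    rewrite odd∧zero (toℕ p) = refl
mate-tail (suc b) (suc (suc p)) (suc (suc q)) = mate-tail b p q

successive-even : ∀ x y → not (isEven y) ∧ (0 <ᵇ y) ∧ (suc x ≡ᵇ y) ≡ successive x y
successive-even x zero    = refl
successive-even x (suc y) = refl

successive-odd : ∀ x y → isEven (suc y) ∧ (0 <ᵇ y) ∧ (suc x ≡ᵇ y) ≡ successive x y
successive-odd x y rewrite isEven-suc y = successive-even x y

relabel : ∀ {n} {G H : Graph n} → (∀ i j → adj H i j ≡ adj G i j) → G ≅ H
relabel eq = record { to = id ; from = id ; from∘to = λ _ → refl ; to∘from = λ _ → refl ; preserve = eq }

F-odd-centre : ∀ y → symm F-odd 0 (1 + y) ≡ isEven y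
F-odd-centre zero = refl
F-odd-centre (suc y) rewrite isEven-suc y with isEven y
... | true  = refl
... | false = refl

F-odd-tail : ∀ x y → symm F-odd (1 + x) (1 + y) ≡ symm successive x y
F-odd-tail x y = cong₂ (λ s t → not (x ≡ᵇ y) ∧ (s ∨ t)) (successive-odd x y) (successive-odd y x)

F-even-centre : ∀ y → symm F-even 0 (2 + y) ≡ isEven y
F-even-centre y with isEven y | 0 <ᵇ y
... | true  | _     = refl
... | false | true  = refl
... | false | false = refl

F-even-tail : ∀ x y → symm F-even (2 + x) (2 + y) ≡ symm successive x y
F-even-tail x y = cong₂ (λ s t → not (x ≡ᵇ y) ∧ (s ∨ t)) (successive-even x y) (successive-even y x)

F-even-short : ∀ y → symm F-even 1 (2 + y) ≡ false
F-even-short zero    = refl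
F-even-short (suc y) rewrite ∧-zeroʳ (not (isEven (suc y))) = refl

T-odd-centre : ∀ y → symm T-odd 0 (3 + y) ≡ isEven y
T-odd-centre y rewrite isEven-suc y with isEven y | 0 <ᵇ y
... | true  | _     = refl
... | false | true  = refl
... | false | false = refl

T-odd-tail : ∀ x y → symm T-odd (3 + x) (3 + y) ≡ symm successive x y
T-odd-tail x y = cong₂ (λ s t → not (x ≡ᵇ y) ∧ (s ∨ t)) (successive-odd x y) (successive-odd y x)

T-odd-short₁ : ∀ y → symm T-odd 1 (3 + y) ≡ false
T-odd-short₁ y rewrite ∧-zeroʳ (0 <ᵇ y) | ∧-zeroʳ (isEven (suc y)) = refl

T-odd-short₂ : ∀ y → symm T-odd 2 (3 + y) ≡ false
T-odd-short₂ zero    = refl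
T-odd-short₂ (suc y) rewrite ∧-zeroʳ (isEven y) = refl

T-even-centre : ∀ y → symm T-even 0 (4 + y) ≡ isEven y
T-even-centre y with isEven y | 0 <ᵇ y
... | true  | _     = refl
... | false | true  = refl
... | false | false = refl

T-even-tail : ∀ x y → symm T-even (4 + x) (4 + y) ≡ symm successive x y
T-even-tail x y = cong₂ (λ s t → not (x ≡ᵇ y) ∧ (s ∨ t)) (successive-even x y) (successive-even y x)

T-even-short₁ : ∀ y → symm T-even 1 (4 + y) ≡ false
T-even-short₁ y rewrite ∧-zeroʳ (0 <ᵇ y) | ∧-zeroʳ (not (isEven y)) = refl

T-even-short₂ : ∀ y → symm T-even 2 (4 + y) ≡ false
T-even-short₂ y rewrite ∧-zeroʳ (0 <ᵇ y) | ∧-zeroʳ (not (isEven y)) = refl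

T-even-short₃ : ∀ y → symm T-even 3 (4 + y) ≡ false
T-even-short₃ zero    = refl
T-even-short₃ (suc y) rewrite ∧-zeroʳ (not (isEven (suc y))) = refl

byParity : ∀ {N} (R R′ : ℕ → ℕ → Bool) → Graph N
byParity {N} R R′ = fromRel (λ i j → (if isEven N then R else R′) (toℕ i) (toℕ j))

byParity-odd : ∀ {N R R′} → isEven N ≡ false → (i j : Fin N) → symm R′ (toℕ i) (toℕ j) ≡ adj (byParity R R′) i j
byParity-odd odd i j rewrite odd = refl

byParity-even : ∀ {N R R′} → isEven N ≡ true → (i j : Fin N) → symm R (toℕ i) (toℕ j) ≡ adj (byParity R R′) i j
byParity-even even i j rewrite even = refl

symm-comm : ∀ R x y → symm R x y ≡ symm R y x
symm-comm R x y = cong₂ (λ s t → not s ∧ t) (≡ᵇ-comm x y) (∨-comm (R x y) (R y x))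
  where
  ≡ᵇ-comm : ∀ x y → (x ≡ᵇ y) ≡ (y ≡ᵇ x)
  ≡ᵇ-comm zero    zero    = refl
  ≡ᵇ-comm zero    (suc y) = refl
  ≡ᵇ-comm (suc x) zero    = refl
  ≡ᵇ-comm (suc x) (suc y) = ≡ᵇ-comm x y

Matches : (ℕ → ℕ → Bool) → List Leg → Set
Matches R ks = ∀ i j → symm R (toℕ i) (toℕ j) ≡ adj (spider ks) i j

-- Both adjacencies are symmetric, so the case analysis can be limited to pairs in order.
UpperMatches : (ℕ → ℕ → Bool) → List Leg → Set
UpperMatches R ks = ∀ i j → i Fin.≤ j → symm R (toℕ i) (toℕ j) ≡ adj (spider ks) i j

upper⇒matches : ∀ {R ks} → UpperMatches R ks → Matches R ks
upper⇒matches {R} {ks} upper i j with ≤-total (toℕ i) (toℕ j)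
... | inj₁ i≤j = upper i j i≤j
... | inj₂ j≤i = trans (symm-comm R (toℕ i) (toℕ j)) (trans (upper j i j≤i) (Graph.sym (spider ks) j i))

F-odd-upper : ∀ b → UpperMatches F-odd (legs 0 b)
F-odd-upper b zero    zero _ = refl
F-odd-upper b zero    (suc q) _ = trans (F-odd-centre (toℕ q)) (≡-sym (foot-tail b q))
F-odd-upper b (suc p) zero ()
F-odd-upper b (suc p) (suc q) _ = trans (F-odd-tail (toℕ p) (toℕ q)) (≡-sym (mate-tail b p q))

F-even-upper : ∀ b → UpperMatches F-even (legs 1 b)
F-even-upper b zero          zero _ = refl
F-even-upper b zero          (suc zero) _ = refl
F-even-upper b zero          (suc (suc q)) _ = trans (F-even-centre (toℕ q)) (≡-sym (foot-tail b q))
F-even-upper b (suc p)       zero ()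
F-even-upper b (suc zero)    (suc zero) _ = refl
F-even-upper b (suc zero)    (suc (suc q)) _ = F-even-short (toℕ q)
F-even-upper b (suc (suc p)) (suc zero) (s≤s ())
F-even-upper b (suc (suc p)) (suc (suc q)) _ = trans (F-even-tail (toℕ p) (toℕ q)) (≡-sym (mate-tail b p q))

T-odd-upper : ∀ b → UpperMatches T-odd (legs 2 b)
T-odd-upper b zero                zero _ = refl
T-odd-upper b zero                (suc zero) _ = refl
T-odd-upper b zero                (suc (suc zero)) _ = refl
T-odd-upper b zero                (suc (suc (suc q))) _ = trans (T-odd-centre (toℕ q)) (≡-sym (foot-tail b q))
T-odd-upper b (suc p)             zero ()
T-odd-upper b (suc zero)          (suc zero) _ = refl
T-odd-upper b (suc zero)          (suc (suc zero)) _ = refl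
T-odd-upper b (suc zero)          (suc (suc (suc q))) _ = T-odd-short₁ (toℕ q)
T-odd-upper b (suc (suc p))       (suc zero) (s≤s ())
T-odd-upper b (suc (suc zero))    (suc (suc zero)) _ = refl
T-odd-upper b (suc (suc zero))    (suc (suc (suc q))) _ = T-odd-short₂ (toℕ q)
T-odd-upper b (suc (suc (suc p))) (suc (suc zero)) (s≤s (s≤s ()))
T-odd-upper b (suc (suc (suc p))) (suc (suc (suc q))) _ = trans (T-odd-tail (toℕ p) (toℕ q)) (≡-sym (mate-tail b p q))

T-even-upper : ∀ b → UpperMatches T-even (legs 3 b)
T-even-upper b zero                      zero _ = refl
T-even-upper b zero                      (suc zero) _ = refl
T-even-upper b zero                      (suc (suc zero)) _ = refl
T-even-upper b zero                      (suc (suc (suc zero))) _ = refl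
T-even-upper b zero                      (suc (suc (suc (suc q)))) _ = trans (T-even-centre (toℕ q)) (≡-sym (foot-tail b q))
T-even-upper b (suc p)                   zero ()
T-even-upper b (suc zero)                (suc zero) _ = refl
T-even-upper b (suc zero)                (suc (suc zero)) _ = refl
T-even-upper b (suc zero)                (suc (suc (suc zero))) _ = refl
T-even-upper b (suc zero)                (suc (suc (suc (suc q)))) _ = T-even-short₁ (toℕ q)
T-even-upper b (suc (suc p))             (suc zero) (s≤s ())
T-even-upper b (suc (suc zero))          (suc (suc zero)) _ = refl
T-even-upper b (suc (suc zero))          (suc (suc (suc zero))) _ = refl
T-even-upper b (suc (suc zero))          (suc (suc (suc (suc q)))) _ = T-even-short₂ (toℕ q)
T-even-upper b (suc (suc (suc p)))       (suc (suc zero)) (s≤s (s≤s ()))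
T-even-upper b (suc (suc (suc zero)))    (suc (suc (suc zero))) _ = refl
T-even-upper b (suc (suc (suc zero)))    (suc (suc (suc (suc q)))) _ = T-even-short₃ (toℕ q)
T-even-upper b (suc (suc (suc (suc p)))) (suc (suc (suc zero))) (s≤s (s≤s (s≤s ())))
T-even-upper b (suc (suc (suc (suc p)))) (suc (suc (suc (suc q)))) _ = trans (T-even-tail (toℕ p) (toℕ q)) (≡-sym (mate-tail b p q))

matches-odd : ∀ {R R′ ks} → isEven (suc (size ks)) ≡ false → Matches R′ ks → spider ks ≅ byParity R R′
matches-odd {R} {R′} odd m = relabel λ i j → trans (≡-sym (byParity-odd {R = R} {R′} odd i j)) (m i j)

matches-even : ∀ {R R′ ks} → isEven (suc (size ks)) ≡ true → Matches R ks → spider ks ≅ byParity R R′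
matches-even {R} {R′} even m = relabel λ i j → trans (≡-sym (byParity-even {R = R} {R′} even i j)) (m i j)

spider≅F₀ : ∀ b → spider (legs 0 b) ≅ F (suc (size (legs 0 b)))
spider≅F₀ b = matches-odd {F-even} (isEven-suc-size b) (upper⇒matches {F-odd} {legs 0 b} (F-odd-upper b))

spider≅F₁ : ∀ b → spider (legs 1 b) ≅ F (suc (size (legs 1 b)))
spider≅F₁ b = matches-even {F-even} {F-odd} (isEven-size b) (upper⇒matches {F-even} {legs 1 b} (F-even-upper b))

spider≅Tn₂ : ∀ b → spider (legs 2 b) ≅ Tn (suc (size (legs 2 b)))
spider≅Tn₂ b = matches-odd {T-even} (isEven-suc-size b) (upper⇒matches {T-odd} {legs 2 b} (T-odd-upper b))

spider≅Tn₃ : ∀ b → spider (legs 3 b) ≅ Tn (suc (size (legs 3 b)))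
spider≅Tn₃ b = matches-even {T-even} {T-odd} (isEven-size b) (upper⇒matches {T-even} {legs 3 b} (T-even-upper b))

-- From a vertex without heavy neighbours to a spider

module _ {n} (G : Graph n) (u : Fin n) where

  -- `xs` holds the neighbours of u treated so far, and `vs` all vertices of their legs in the
  -- numbering of `spider ks`. The conditions on c say that a leg has no edges other than its own.
  data Layout : List (Fin n) → (ks : List Leg) → Vec (Fin n) (size ks) → Set where
    []    : Layout [] [] []
    short : ∀ {a xs ks vs} → Adj G u a → (∀ c → Adj G a c → c ≡ u) →
      Layout xs ks vs → Layout (a ∷ xs) (short ∷ ks) (a ∷ vs)
    long  : ∀ {a b xs ks vs} → Adj G u a → Adj G a b → ¬ b ≡ u →
      (∀ c → Adj G a c → c ≡ u ⊎ c ≡ b) → (∀ c → Adj G b c → c ≡ a) →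
      Layout xs ks vs → Layout (a ∷ xs) (long ∷ ks) (a ∷ b ∷ vs)

  far≁u : ∀ {a b} → Adj G u a → (∀ c → Adj G b c → c ≡ a) → ¬ Adj G u b
  far≁u ua only ub = adj⇒≢ G ua (only u (adj-sym G ub))

  -- Adjacency to u tells feet from far ends, and either kind is traced back to a foot in `xs`; so
  -- distinctness of the feet alone keeps the legs disjoint.
  origin : ∀ {xs ks vs} → Layout xs ks vs → ∀ i →
    (Adj G u (lookup vs i) × lookup vs i ∈ xs) ⊎ (¬ Adj G u (lookup vs i) × ∃ λ a → a ∈ xs × Adj G (lookup vs i) a)
  origin (short ua _ lay) zero = inj₁ (ua , here refl)
  origin (short ua _ lay) (suc i) with origin lay i
  ... | inj₁ (ui , i∈)          = inj₁ (ui , there i∈)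
  ... | inj₂ (¬ui , a , a∈ , e) = inj₂ (¬ui , a , there a∈ , e)
  origin (long ua ab b≢u onlyA onlyB lay) zero = inj₁ (ua , here refl)
  origin (long ua ab b≢u onlyA onlyB lay) (suc zero) = inj₂ (far≁u ua onlyB , _ , here refl , adj-sym G ab)
  origin (long ua ab b≢u onlyA onlyB lay) (suc (suc i)) with origin lay i
  ... | inj₁ (ui , i∈)          = inj₁ (ui , there i∈)
  ... | inj₂ (¬ui , a , a∈ , e) = inj₂ (¬ui , a , there a∈ , e)

  foot-fresh : ∀ {xs ks vs a} → Layout xs ks vs → Adj G u a → All (λ x → ¬ a ≡ x) xs → Fresh a vs
  foot-fresh lay ua a∉ i refl with origin lay i
  ... | inj₁ (_ , i∈)  = All.lookup a∉ i∈ refl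
  ... | inj₂ (¬ui , _) = ¬ui ua

  -- If b were already laid out it would be no foot, as it is not adjacent to u, and as a far end it
  -- would have its neighbour in `xs`; but its only neighbour is a.
  far-fresh : ∀ {xs ks vs a b} → Layout xs ks vs → Adj G u a → (∀ c → Adj G b c → c ≡ a) →
    All (λ x → ¬ a ≡ x) xs → Fresh b vs
  far-fresh lay ua only a∉ i refl with origin lay i
  ... | inj₁ (ub , _)          = far≁u ua only ub
  ... | inj₂ (_ , x , x∈ , bx) = All.lookup a∉ x∈ (≡-sym (only x bx))

  layout-injective : ∀ {xs ks vs} → Layout xs ks vs → Unique xs → Distinct vs
  layout-injective [] _ {()}
  layout-injective {vs = _ ∷ vs} (short ua _ lay) (a∉ ∷ xs!) = injective-∷ {vs = vs} (foot-fresh lay ua a∉) (layout-injective lay xs!)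
  layout-injective {vs = a ∷ b ∷ vs} (long ua ab b≢u onlyA onlyB lay) (a∉ ∷ xs!) =
    injective-∷ {vs = b ∷ vs} (λ { zero eq → adj⇒≢ G ab (≡-sym eq) ; (suc i) → foot-fresh lay ua a∉ i })
      (injective-∷ {vs = vs} (far-fresh lay ua onlyB a∉) (layout-injective lay xs!))

  layout-foot : ∀ {xs ks vs} → Layout xs ks vs → ∀ i → adj G u (lookup vs i) ≡ foot ks i
  layout-foot (short ua _ lay) zero = ua
  layout-foot (short ua _ lay) (suc i) = layout-foot lay i
  layout-foot (long ua ab b≢u onlyA onlyB lay) zero = ua
  layout-foot (long ua ab b≢u onlyA onlyB lay) (suc zero) = ¬-not (far≁u ua onlyB)
  layout-foot (long ua ab b≢u onlyA onlyB lay) (suc (suc i)) = layout-foot lay i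

  u-fresh : ∀ {xs ks vs} → Layout xs ks vs → Fresh u vs
  u-fresh (short ua _ lay) zero eq = adj⇒≢ G ua (≡-sym eq)
  u-fresh (short ua _ lay) (suc i) = u-fresh lay i
  u-fresh (long ua ab b≢u onlyA onlyB lay) zero eq = adj⇒≢ G ua (≡-sym eq)
  u-fresh (long ua ab b≢u onlyA onlyB lay) (suc zero) = b≢u
  u-fresh (long ua ab b≢u onlyA onlyB lay) (suc (suc i)) = u-fresh lay i

  adj-comm : ∀ {x y b} → adj G x y ≡ b → adj G y x ≡ b
  adj-comm {x} {y} eq = trans (Graph.sym G y x) eq

  short-tail : ∀ {a xs ks vs} → (∀ c → Adj G a c → c ≡ u) → Layout xs ks vs → ∀ j → adj G a (lookup vs j) ≡ false
  short-tail only lay j = ¬-not λ aj → u-fresh lay j (only _ aj)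

  near-tail : ∀ {a b xs ks vs} → Adj G u a → (∀ c → Adj G a c → c ≡ u ⊎ c ≡ b) → (∀ c → Adj G b c → c ≡ a) →
    Layout xs ks vs → All (λ x → ¬ a ≡ x) xs → ∀ j → adj G a (lookup vs j) ≡ false
  near-tail ua onlyA onlyB lay a∉ j = ¬-not λ aj →
    [ u-fresh lay j , far-fresh lay ua onlyB a∉ j ]′ (onlyA _ aj)

  far-tail : ∀ {a b xs ks vs} → Adj G u a → (∀ c → Adj G b c → c ≡ a) →
    Layout xs ks vs → All (λ x → ¬ a ≡ x) xs → ∀ j → adj G b (lookup vs j) ≡ false
  far-tail ua onlyB lay a∉ j = ¬-not λ bj → foot-fresh lay ua a∉ j (onlyB _ bj)

  layout-mate : ∀ {xs ks vs} → Layout xs ks vs → Unique xs → ∀ i j → adj G (lookup vs i) (lookup vs j) ≡ mate ks i j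
  layout-mate (short ua only lay) (a∉ ∷ xs!) zero zero = irrefl G _
  layout-mate (short ua only lay) (a∉ ∷ xs!) zero (suc j) = short-tail only lay j
  layout-mate (short ua only lay) (a∉ ∷ xs!) (suc i) zero = adj-comm (short-tail only lay i)
  layout-mate (short ua only lay) (a∉ ∷ xs!) (suc i) (suc j) = layout-mate lay xs! i j
  layout-mate (long ua ab b≢u onlyA onlyB lay) (a∉ ∷ xs!) zero zero = irrefl G _
  layout-mate (long ua ab b≢u onlyA onlyB lay) (a∉ ∷ xs!) zero (suc zero) = ab
  layout-mate (long ua ab b≢u onlyA onlyB lay) (a∉ ∷ xs!) zero (suc (suc j)) = near-tail ua onlyA onlyB lay a∉ j
  layout-mate (long ua ab b≢u onlyA onlyB lay) (a∉ ∷ xs!) (suc zero) zero = adj-comm ab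
  layout-mate (long ua ab b≢u onlyA onlyB lay) (a∉ ∷ xs!) (suc zero) (suc zero) = irrefl G _
  layout-mate (long ua ab b≢u onlyA onlyB lay) (a∉ ∷ xs!) (suc zero) (suc (suc j)) = far-tail ua onlyB lay a∉ j
  layout-mate (long ua ab b≢u onlyA onlyB lay) (a∉ ∷ xs!) (suc (suc i)) zero = adj-comm (near-tail ua onlyA onlyB lay a∉ i)
  layout-mate (long ua ab b≢u onlyA onlyB lay) (a∉ ∷ xs!) (suc (suc i)) (suc zero) = adj-comm (far-tail ua onlyB lay a∉ i)
  layout-mate (long ua ab b≢u onlyA onlyB lay) (a∉ ∷ xs!) (suc (suc i)) (suc (suc j)) = layout-mate lay xs! i j

  layout-adj : ∀ {xs ks vs} → Layout xs ks vs → Unique xs → ∀ i j → adj G (lookup (u ∷ vs) i) (lookup (u ∷ vs) j) ≡ adj (spider ks) i j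
  layout-adj lay xs! zero    zero    = irrefl G u
  layout-adj lay xs! zero    (suc j) = layout-foot lay j
  layout-adj lay xs! (suc i) zero    = adj-comm (layout-foot lay i)
  layout-adj lay xs! (suc i) (suc j) = layout-mate lay xs! i j

  layout-∈ : ∀ {xs ks vs a} → Layout xs ks vs → a ∈ xs → Reached G vs a
  layout-∈ (short ua _ lay) (here refl) = zero , refl
  layout-∈ (short ua _ lay) (there a∈) with layout-∈ lay a∈
  ... | i , eq = suc i , eq
  layout-∈ (long ua ab b≢u onlyA onlyB lay) (here refl) = zero , refl
  layout-∈ (long ua ab b≢u onlyA onlyB lay) (there a∈) with layout-∈ lay a∈
  ... | i , eq = suc (suc i) , eq

  layout-closed : ∀ {xs ks vs} → Layout xs ks vs → ∀ i c → Adj G (lookup vs i) c → Reached G (u ∷ vs) c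
  layout-closed (short ua only lay) zero c ac = zero , ≡-sym (only c ac)
  layout-closed (short ua only lay) (suc i) c ic with layout-closed lay i c ic
  ... | zero  , eq = zero , eq
  ... | suc j , eq = suc (suc j) , eq
  layout-closed (long ua ab b≢u onlyA onlyB lay) zero c ac with onlyA c ac
  ... | inj₁ refl = zero , refl
  ... | inj₂ refl = suc (suc zero) , refl
  layout-closed (long ua ab b≢u onlyA onlyB lay) (suc zero) c bc = suc zero , ≡-sym (onlyB c bc)
  layout-closed (long ua ab b≢u onlyA onlyB lay) (suc (suc i)) c ic with layout-closed lay i c ic
  ... | zero  , eq = zero , eq
  ... | suc j , eq = suc (suc (suc j)) , eq

  -- When `xs` contains all neighbours of u, the vertices u ∷ vs are closed under adjacency, so by
  -- connectedness nothing else exists. The map `to` returns the position at which a vertex is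
  -- reached.
  layout⇒≅ : ∀ {xs ks vs} → Connected G → (∀ a → Adj G u a → a ∈ xs) → Unique xs → Layout xs ks vs → G ≅ spider ks
  layout⇒≅ {xs} {ks} {vs} connected complete xs! lay = record
    { to = λ w → proj₁ (reach w)
    ; from = lookup (u ∷ vs)
    ; from∘to = λ w → proj₂ (reach w)
    ; to∘from = λ i → inj (proj₂ (reach (lookup (u ∷ vs) i)))
    ; preserve = λ v w → trans (≡-sym (layout-adj lay xs! (proj₁ (reach v)) (proj₁ (reach w))))
        (cong₂ (adj G) (proj₂ (reach v)) (proj₂ (reach w))) }
    where
    inj : Distinct (u ∷ vs)
    inj = injective-∷ {vs = vs} (u-fresh lay) (layout-injective lay xs!)
    closed : ∀ i → Closed G (u ∷ vs) (lookup (u ∷ vs) i)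
    closed zero    w uw with layout-∈ lay (complete w uw)
    ... | i , eq = suc i , eq
    closed (suc i) w iw = layout-closed lay i w iw
    reach : ∀ w → Reached G (u ∷ vs) w
    reach w = closed⇒reached G {vs = u ∷ vs} closed (connected u w) (zero , refl)

  module _ (light : ¬ HeavyNeighbour G u) where

    Extended : Fin n → Set
    Extended a = ∃ λ b → Adj G a b × ¬ b ≡ u

    extended? : ∀ a → Dec (Extended a)
    extended? a = any? λ b → adj? G a b ×-dec ¬? (b Fin.≟ u)

    -- Lightness of u ends each leg after b: a further neighbour of a (fork) or of b (path) would be
    -- the third vertex that makes a heavy.
    long-layout : ∀ xs → All (λ a → Adj G u a × Extended a) xs → ∃ λ b → ∃ λ vs → Layout xs (replicate b long) vs
    long-layout [] [] = 0 , [] , []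
    long-layout (a ∷ xs) ((ua , b , ab , b≢u) ∷ all) with long-layout xs all
    ... | m , vs , lay = suc m , a ∷ b ∷ vs , long ua ab b≢u onlyA onlyB lay
      where
      onlyA : ∀ c → Adj G a c → c ≡ u ⊎ c ≡ b
      onlyA c ac with c Fin.≟ u | c Fin.≟ b
      ... | yes eq | _      = inj₁ eq
      ... | no _   | yes eq = inj₂ eq
      ... | no c≢u | no c≢b = contradiction (a , ua , b , ab , b≢u , inj₁ (c , ac , c≢u , c≢b)) light
      onlyB : ∀ c → Adj G b c → c ≡ a
      onlyB c bc with c Fin.≟ a
      ... | yes eq = eq
      ... | no c≢a = contradiction (a , ua , b , ab , b≢u , inj₂ (c , bc , c≢a)) light

    short-layout : ∀ {ys b vs} xs → All (λ a → Adj G u a × ¬ Extended a) xs → Layout ys (replicate b long) vs →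
      ∃ λ a → ∃ λ ws → Layout (xs ++ ys) (legs a b) ws
    short-layout [] [] lay = 0 , _ , lay
    short-layout (a ∷ xs) ((ua , leaf) ∷ all) lay with short-layout xs all lay
    ... | m , vs , lay′ = suc m , a ∷ vs , short ua only lay′
      where
      only : ∀ c → Adj G a c → c ≡ u
      only c ac with c Fin.≟ u
      ... | yes eq = eq
      ... | no c≢u = contradiction (c , ac , c≢u) leaf

    light⇒spider : Connected G → ∃ λ a → ∃ λ b → G ≅ spider (legs a b)
    light⇒spider connected =
      let b , vs , lay  = long-layout longs (All.tabulate (proj₂ ∘ ∈-filter⁻ long? {xs = List.allFin n}))
          a , ws , lay′ = short-layout shorts (All.tabulate (proj₂ ∘ ∈-filter⁻ short? {xs = List.allFin n})) lay
      in a , b , layout⇒≅ connected complete distinct lay′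
      where
      long? : ∀ a → Dec (Adj G u a × Extended a)
      long? a = adj? G u a ×-dec extended? a
      short? : ∀ a → Dec (Adj G u a × ¬ Extended a)
      short? a = adj? G u a ×-dec ¬? (extended? a)
      longs shorts : List (Fin n)
      longs = filter long? (List.allFin n)
      shorts = filter short? (List.allFin n)
      complete : ∀ a → Adj G u a → a ∈ shorts ++ longs
      complete a ua with extended? a
      ... | yes ext = ∈-++⁺ʳ shorts (∈-filter⁺ long? (∈-allFin a) (ua , ext))
      ... | no leaf = ∈-++⁺ˡ (∈-filter⁺ short? (∈-allFin a) (ua , leaf))
      distinct : Unique (shorts ++ longs)
      distinct = Unique.++⁺ (Unique.filter⁺ short? (Unique.allFin⁺ n)) (Unique.filter⁺ long? (Unique.allFin⁺ n))
        λ (s , l) → proj₂ (proj₂ (∈-filter⁻ short? {xs = List.allFin n} s)) (proj₂ (proj₂ (∈-filter⁻ long? {xs = List.allFin n} l)))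

-- Comparing spiders

Extremal : ∀ {n} → Graph n → Set
Extremal {n} G = (d G ≤ h n) × ((d G ≡ h n) ⇔ (G ≅ Tn n))

-- At most three short legs and one long leg give order at most 6. The conclusion provides the form
-- 2 + b on which the evaluation of `h` relies.
2≤legs : ∀ a b → a ≤ 3 → 9 ≤ suc (size (legs a b)) → 2 ≤ b
2≤legs a b a≤3 9≤ = ≮⇒≥ λ b<2 → <⇒≱ {suc (size (legs a b))} {9}
  (s≤s (≤-trans (s≤s (≤-trans (≤-reflexive (size-legs a b)) (+-mono-≤ a≤3 (*-monoˡ-≤ 2 (s≤s⁻¹ b<2))))) (m≤m+n 6 2))) 9≤

d-spider₂≡h : ∀ b → 9 ≤ suc (size (legs 2 b)) → d (spider (legs 2 b)) ≡ h (suc (size (legs 2 b)))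
d-spider₂≡h b 9≤ with b | 2≤legs 2 b (n≤1+n 2) 9≤
... | suc (suc b) | _ = d-spider-2 b
... | suc zero    | s≤s ()

d-spider₃≡h : ∀ b → 9 ≤ suc (size (legs 3 b)) → d (spider (legs 3 b)) ≡ h (suc (size (legs 3 b)))
d-spider₃≡h b 9≤ with b | 2≤legs 3 b ≤-refl 9≤
... | suc (suc b) | _ = d-spider-3 b
... | suc zero    | s≤s ()

-- One exchange is already strict, so the spider it leads to needs only a weak bound. Exchanges keep
-- the order and lower the number of short legs by two, so they end at 2 or 3, where `h` is
-- attained.
many-d<h : ∀ a b → 9 ≤ suc (size (legs (4 + a) b)) → d (spider (legs (4 + a) b)) < h (suc (size (legs (4 + a) b)))
many-d<h a b 9≤ = <-≤-trans (exchange-< (suc a) b)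
  (subst (λ N → d (spider (legs (2 + a) (suc b))) ≤ h (suc N)) (size-exchange (2 + a) b)
    (rest a (subst (λ N → 9 ≤ suc N) (≡-sym (size-exchange (2 + a) b)) 9≤)))
  where
  rest : ∀ a → 9 ≤ suc (size (legs (2 + a) (suc b))) →
    d (spider (legs (2 + a) (suc b))) ≤ h (suc (size (legs (2 + a) (suc b))))
  rest zero          9≤ = ≤-reflexive (d-spider₂≡h (suc b) 9≤)
  rest (suc zero)    9≤ = ≤-reflexive (d-spider₃≡h (suc b) 9≤)
  rest (suc (suc a)) 9≤ = <⇒≤ (many-d<h a (suc b) 9≤)

equal⇒extremal : ∀ {n} {G : Graph n} → d G ≡ h n → G ≅ Tn n → Extremal G
equal⇒extremal eq iso = ≤-reflexive eq , mk⇔ (λ _ → iso) (λ _ → eq)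

size-parity : ∀ m → ∃ λ b → m ≡ size (legs 0 b) ⊎ m ≡ size (legs 1 b)
size-parity zero       = 0 , inj₁ refl
size-parity (suc zero) = 0 , inj₂ refl
size-parity (suc (suc m)) with size-parity m
... | b , inj₁ refl = suc b , inj₁ refl
... | b , inj₂ refl = suc b , inj₂ refl

d-Tn : ∀ n → 9 ≤ n → d (Tn n) ≡ h n
d-Tn (suc (suc (suc m))) 9≤n with size-parity m
-- Three vertices, the centre and two short legs, were split off from n; the remaining m consist of
-- long legs and, if m is odd, a third short leg.
... | b , inj₁ refl = trans (≅⇒d≡ (≅-sym (spider≅Tn₂ b))) (d-spider₂≡h b 9≤n)
... | b , inj₂ refl = trans (≅⇒d≡ (≅-sym (spider≅Tn₃ b))) (d-spider₃≡h b 9≤n)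
d-Tn 1 (s≤s ())
d-Tn 2 (s≤s (s≤s ()))

-- Under a strict inequality both sides of the equivalence fail, the second because `Tn n` attains
-- `h n`.
less⇒extremal : ∀ {n} {G : Graph n} → 9 ≤ n → d G < h n → Extremal G
less⇒extremal {n} 9≤n lt = <⇒≤ lt , mk⇔ (λ eq → contradiction eq (<⇒≢ lt))
  (λ iso → contradiction (trans (≅⇒d≡ iso) (d-Tn n 9≤n)) (<⇒≢ lt))

spider-extremal : ∀ a b {n} {G : Graph n} → 9 ≤ n → n ≡ suc (size (legs a b)) → G ≅ spider (legs a b) → ¬ (G ≅ F n) → Extremal G
spider-extremal 0 b 9≤n refl iso ≇F = contradiction (≅-trans iso (spider≅F₀ b)) ≇F
spider-extremal 1 b 9≤n refl iso ≇F = contradiction (≅-trans iso (spider≅F₁ b)) ≇F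
spider-extremal 2 b 9≤n refl iso _  = equal⇒extremal (trans (≅⇒d≡ iso) (d-spider₂≡h b 9≤n)) (≅-trans iso (spider≅Tn₂ b))
spider-extremal 3 b 9≤n refl iso _  = equal⇒extremal (trans (≅⇒d≡ iso) (d-spider₃≡h b 9≤n)) (≅-trans iso (spider≅Tn₃ b))
spider-extremal (suc (suc (suc (suc a)))) b 9≤n refl iso _ =
  less⇒extremal 9≤n (≤-<-trans (≤-reflexive (≅⇒d≡ iso)) (many-d<h a b 9≤n))

theorem3p2 : (n : ℕ) → 9 ≤ n → (T : Graph n) → IsTree T → ¬ (T ≅ F n) →
    (d T ≤ h n) × ((d T ≡ h n) ⇔ (T ≅ Tn n))
theorem3p2 n 9≤n T tree ≇F with light-vertex-or-d< T tree 9≤n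
... | inj₂ lt = less⇒extremal 9≤n lt
... | inj₁ (u , light) with light⇒spider T u light (proj₁ tree)
... | a , b , iso = spider-extremal a b 9≤n (≅-order iso) iso ≇F
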